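{- Let $\mathcal{D}$ be a Steiner system $S(5,6,12)$ with point set $[12]$. The orbit $O(\mathcal{D})$ has $5040$ elements, and the game distribution $F_{\mathcal{D}}$ of $\mathcal{D}$ is nonzero exactly for $n=905,\dots,916$, with the following values: $F_{\mathcal{D}}(905)=1$, $F_{\mathcal{D}}(906)=10$, $F_{\mathcal{D}}(907)=42$, $F_{\mathcal{D}}(908)=150$, $F_{\mathcal{D}}(909)=351$, $F_{\mathcal{D}}(910)=650$, $F_{\mathcal{D}}(911)=1012$, $F_{\mathcal{D}}(912)=1237$, $F_{\mathcal{D}}(913)=939$, $F_{\mathcal{D}}(914)=532$, $F_{\mathcal{D}}(915)=115$, $F_{\mathcal{D}}(916)=1$. Moreover, $\Gamma_{12,6}[\bar{\mathcal{P}}(\mathcal{D}^{sh})]$ is the hexad game $\mathcal{H}$, and $\mathcal{D}^{sh}$ is the unique element $\mathcal{D}'\in O(\mathcal{D})$ with $|\bar{\mathcal{P}}(\mathcal{D}')|=905$, which is the minimum value.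
   Context: $[v]=\{0,\dots,v-1\}$. A Steiner system $S(t,k,v)$ with point set $[v]$ is a pair $([v],\mathcal{B})$ with $\mathcal{B}\subseteq\binom{[v]}{k}$ such that every $t$-subset of $[v]$ lies in exactly one block. Welter's game $\Gamma_{v,k}$ is the digraph on $\binom{[v]}{k}$ with edges $(P,P^{(p\,q)})$ for $q<p$, $p\in P$, $q\notin P$, where $P^{(p\,q)}=(P\setminus\{p\})\cup\{q\}$. For a block set $\mathcal{B}$ of $\mathcal{D}$, set $$\bar{\mathcal{P}}(\mathcal{D})=\mathcal{B}\cup\bigcup_{B\in\mathcal{B}}\{R:(R,B)\text{ is an edge of }\Gamma_{v,k}\}.$$ For $\pi\in\mathrm{Sym}([v])$, $\mathcal{D}^\pi=([v],\{B^\pi:B\in\mathcal{B}\})$. The orbit is $O(\mathcal{D})=\{\mathcal{D}^\pi:\pi\in\mathrm{Sym}([v])\}$, and the game distribution is $F_{\mathcal{D}}(n)=|\{\mathcal{D}'\in O(\mathcal{D}):|\bar{\mathcal{P}}(\mathcal{D}')|=n\}|$. The hexad game $\mathcal{H}$ is the subgraph of $\Gamma_{12,6}$ induced by $\{P\in\binom{[12]}{6}:\sum_{p\in P}p\ge 21\}$. Its $\mathsf{P}$-position set is the set of positions with outcome $\mathsf{P}$, where outcomes are defined recursively: a position is $\mathsf{N}$ if some out-neighbor is $\mathsf{P}$, and $\mathsf{P}$ otherwise. Let $\mathcal{D}^{sh}=([12],\mathsf{P}\text{ -position set of }\mathcal{H})$. It is known that $\mathcal{D}^{sh}$ is an $S(5,6,12)$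 (the shuffle numbering), and that all $S(5,6,12)$ on $[12]$ are isomorphic, so $\mathcal{D}^{sh}\in O(\mathcal{D})$. -}

module Defs where

open import Data.Bool using (Bool; true; false; _∧_; _∨_; not; if_then_else_)
open import Data.Nat using (ℕ; zero; suc; _+_; _≤_; _<_; _≡ᵇ_; _<ᵇ_; _≤ᵇ_)
open import Data.Fin using (Fin; toℕ)
open import Data.Fin.Subset using (Subset; _∈_; _⊆_; ∣_∣; inside; outside)
open import Data.Vec using (Vec; []; _∷_; lookup; tabulate; _[_]≔_; toList)
open import Data.List using (List; []; _∷_; map; concatMap; filterᵇ; length; allFin)
open import Data.Nat.ListAction using (sum)
open import Data.Bool.ListAction using (any)
open import Data.List.Relation.Unary.Any using (Any)
open import Data.List.Relation.Unary.AllPairs using (AllPairs)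
open import Data.Fin.Permutation using (Permutation′; _⟨$⟩ʳ_)
open import Data.Product using (Σ; _×_; ∃)
open import Relation.Binary.PropositionalEquality using (_≡_)
open import Relation.Nullary using (¬_; does)

-- A subset of [v] = {0,…,v-1} is a characteristic vector (Data.Fin.Subset).
-- A block set 𝓑 ⊆ Subsets([v]) is given by its (Boolean) membership function.
BlockSet : ℕ → Set
BlockSet v = Subset v → Bool

_≈D_ : ∀ {v} → BlockSet v → BlockSet v → Set
_≈D_ {v} 𝓑 𝓒 = (C : Subset v) → 𝓑 C ≡ 𝓒 C

IsSteiner : (t k v : ℕ) → BlockSet v → Set
IsSteiner t k v 𝓑 =
  ((B : Subset v) → 𝓑 B ≡ true → ∣ B ∣ ≡ k) ×
  ((T : Subset v) → ∣ T ∣ ≡ t →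
     Σ (Subset v) (λ B → 𝓑 B ≡ true × T ⊆ B) ×
     ((B B′ : Subset v) → 𝓑 B ≡ true → T ⊆ B → 𝓑 B′ ≡ true → T ⊆ B′ → B ≡ B′))

allSubsets : (n : ℕ) → List (Subset n)
allSubsets zero = [] ∷ []
allSubsets (suc n) = concatMap (λ s → (false ∷ s) ∷ (true ∷ s) ∷ []) (allSubsets n)

preimage : ∀ {v} → Permutation′ v → Subset v → Subset v
preimage π C = tabulate (λ y → lookup C (π ⟨$⟩ʳ y))

-- Block set of 𝓓^π: C is a block of 𝓓^π iff C = B^π for a block B,
-- i.e. iff π⁻¹(C) = {y : π(y) ∈ C} is a block of 𝓓.
act : ∀ {v} → Permutation′ v → BlockSet v → BlockSet v
act π 𝓑 C = 𝓑 (preimage π C)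

IsOrbitEnum : ∀ {v} → BlockSet v → List (Permutation′ v) → Set
IsOrbitEnum 𝓑 L =
  AllPairs (λ σ τ → ¬ (act σ 𝓑 ≈D act τ 𝓑)) L ×
  (∀ π → Any (λ σ → act π 𝓑 ≈D act σ 𝓑) L)

elems : ∀ {v} → Subset v → List (Fin v)
elems {v} P = filterᵇ (λ x → lookup P x) (allFin v)

sumS : ∀ {v} → Subset v → ℕ
sumS P = sum (map toℕ (elems P))

swap : ∀ {v} → Subset v → Fin v → Fin v → Subset v
swap P p q = (P [ p ]≔ false) [ q ]≔ true

moves : ∀ {v} → Subset v → List (Subset v)
moves {v} P =
  concatMap (λ p → concatMap (λ q →
      if lookup P p ∧ not (lookup P q) ∧ (toℕ q <ᵇ toℕ p)
      then swap P p q ∷ [] else []) (allFin v)) (allFin v)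

-- R ∈ P̄(𝓓) for 𝓓 with blocks 𝓑 (vertices of Γ_{v,k} are k-subsets):
-- R ∈ 𝓑, or (R,B) is an edge of Γ_{v,k} for some B ∈ 𝓑.
inPbar : ∀ {v} → ℕ → BlockSet v → Subset v → Bool
inPbar k 𝓑 R = (∣ R ∣ ≡ᵇ k) ∧ (𝓑 R ∨ any 𝓑 (moves R))

cardPbar : BlockSet 12 → ℕ
cardPbar 𝓑 = length (filterᵇ (inPbar 6 𝓑) (allSubsets 12))

gameDist : BlockSet 12 → List (Permutation′ 12) → ℕ → ℕ
gameDist 𝓑 L n = length (filterᵇ (λ σ → cardPbar (act σ 𝓑) ≡ᵇ n) L)

inH : Subset 12 → Bool
inH P = (∣ P ∣ ≡ᵇ 6) ∧ (21 ≤ᵇ sumS P)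

-- outcome with fuel: true = P-position (no move in ℋ to a P-position).
-- Every move decreases sumS strictly, so fuel = sumS P is exact.
isPfuel : ℕ → Subset 12 → Bool
isPfuel zero P = true
isPfuel (suc n) P = not (any (λ Q → inH Q ∧ isPfuel n Q) (moves P))

isP : Subset 12 → Bool
isP P = isPfuel (sumS P) P

Dsh : BlockSet 12
Dsh P = inH P ∧ isP P

paperTable : ℕ → ℕ
paperTable n =
  if n ≡ᵇ 905 then 1 else
  if n ≡ᵇ 906 then 10 else
  if n ≡ᵇ 907 then 42 else
  if n ≡ᵇ 908 then 150 else
  if n ≡ᵇ 909 then 351 else
  if n ≡ᵇ 910 then 650 else
  if n ≡ᵇ 911 then 1012 else
  if n ≡ᵇ 912 then 1237 else
  if n ≡ᵇ 913 then 939 else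
  if n ≡ᵇ 914 then 532 else
  if n ≡ᵇ 915 then 115 else
  if n ≡ᵇ 916 then 1 else 0

{-# OPTIONS --safe #-}
-- Every S(5,6,12) is carried to the shuffle numbering 𝓓 by a permutation of 5,…,11: a search over
-- the blocks through a few 5-sets, cut down by transpositions preserving the blocks known so far,
-- leads to five blocks from which all 132 follow, since distinct blocks never share five points.
-- Only the identity of Sym{5,…,11} fixes 𝓓, so the orbit consists of the 7! = 5040 systems 𝓓^σ.
--
-- Call a 6-set R bad if it lies outside P̄, so that |P̄| = 924 − #bad. For p ∈ R the block
-- through R∖p is then R∖p ∪ c(p) with c(p) ∉ R and c(p) > p, and c is injective, because two blocks
-- R∖p ∪ q and R∖p′ ∪ q share five points. Hence a bad set is one of the 132 ballot sequences, and
-- |P̄(𝓓^σ)| is computed from these for all σ, by a tree search on the values of σ.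
module Submission where

open import Defs
open import Data.Bool using (true)
open import Data.Nat using (ℕ; _≤_)
open import Data.List using (List; length)
open import Data.Fin.Subset using (Subset)
open import Data.Fin.Permutation using (Permutation′)
open import Data.Product using (Σ; _×_)
open import Relation.Binary.PropositionalEquality using (_≡_)
open import Function.Bundles using (_⇔_)

open import Algebra.Bundles using (CommutativeMonoid)
open import Data.Bool using (Bool; false; T; _∧_; _∨_; not; if_then_else_)
open import Data.Bool.ListAction using (any; all)
import Data.Bool.Properties as Boolₚ
open import Data.Fin as Fin using (Fin; zero; suc; toℕ; _↑ʳ_; #_; punchIn)
import Data.Fin.Properties as Finₚ
open import Data.Fin.Permutation using (_⟨$⟩ʳ_; _⟨$⟩ˡ_; _∘ₚ_; inverseˡ; inverseʳ; transpose; lift₀; lift₀-cong; insert; remove; insert-punchIn; insert-remove) renaming (flip to flipₚ; _≈_ to _≈ₚ_; id to idₚ)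
open import Data.Fin.Subset using (_⊆_; _∩_; ∣_∣; ∁; ⊥)
open import Data.Fin.Subset.Properties using (drop-∷-⊆; p⊆q⇒∣p∣≤∣q∣; p∩q⊆p; p∩q⊆q; ∩-idem)
open import Data.List as List using ([]; _∷_; _++_; map; foldr; concatMap; filterᵇ; allFin)
open import Data.List.Membership.Propositional using (lose; find) renaming (_∈_ to _∈ₗ_)
open import Data.List.Membership.Propositional.Properties using (∈-map⁺; ∈-allFin; ∈-concatMap⁺)
import Data.List.Properties as Listₚ
open import Data.List.Relation.Binary.Permutation.Propositional using (_↭_; ↭-refl; ↭-trans; ↭-prep; ↭-swap)
open import Data.List.Relation.Binary.Permutation.Propositional.Properties using (↭-length; filter-↭)
open import Data.List.Relation.Unary.All as All using (All; []; _∷_)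
import Data.List.Relation.Unary.All.Properties as Allₚ
open import Data.List.Relation.Unary.AllPairs as AllPairs using (AllPairs; []; _∷_)
import Data.List.Relation.Unary.AllPairs.Properties as AllPairsₚ
open import Data.List.Relation.Unary.Any as Any using (Any; here; there)
import Data.List.Relation.Unary.Any.Properties as Anyₚ
open import Data.List.Relation.Unary.Unique.Propositional.Properties using (allFin⁺; filter⁺)
open import Data.Nat using (zero; suc; _+_; _*_; _∸_; _≡ᵇ_; _<ᵇ_; _≤ᵇ_; _<_; z≤n; s≤s; s≤s⁻¹; s<s⁻¹; _/_; _%_)
open import Data.Nat.ListAction using (sum)
open import Data.Nat.Properties as ℕₚ using (+-suc; suc-injective)
open import Data.Product using (∃; ∃-syntax; _,_; proj₁; proj₂)
open import Data.Sum using (_⊎_; inj₁; inj₂)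
open import Data.Vec as Vec using (Vec; []; _∷_; lookup; tabulate; _[_]≔_; removeAt)
open import Data.Vec.Properties using ([]=⇒lookup; lookup⇒[]=; lookup-map; lookup∘tabulate; tabulate∘lookup; tabulate-cong; lookup∘update; lookup∘update′; []≔-idempotent; []≔-lookup; ≡-dec)
open import Function using (_∘_; id; mk⇔)
open import Level using (0ℓ)
open import Relation.Binary.Definitions using (DecidableEquality; tri<; tri≈; tri>)
open import Relation.Binary.PropositionalEquality using (_≢_; refl; sym; trans; cong; cong₂; subst; subst₂; module ≡-Reasoning)
open import Relation.Nullary using (¬_; yes; no; contradiction; does)

-- Five points can be held fixed because the automorphism group of an S(5,6,12), the Mathieu group
-- M12, is sharply 5-transitive: each of its cosets in the symmetric group contains exactly one
-- permutation fixing 0,...,4. This is not presupposed. `search` supplies the existence of such a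
-- relabelling and `rigid-perms` its uniqueness. The passage to bad sets makes the count feasible: a
-- system has only 8 to 19 of them, and 132 candidates (the Catalan number C_6, counting paths here
-- and not blocks) replace 924 six-sets. The shape of these candidates and of their moves does not
-- depend on the numbering, which enters only through the codes of the points. So the enumeration of
-- the candidates is compared with the ballot sequences once, symbolically, and the same recursion
-- is then run on numbers for all 5040 systems.

private variable
  A A′ X Y W V : Set
  n : ℕ

-- Booleans, counting and finite subsets

∧-trueˡ : ∀ {a b} → a ∧ b ≡ true → a ≡ true
∧-trueˡ {a} {b} = Boolₚ.∧-conicalˡ a b

∧-trueʳ : ∀ {a b} → a ∧ b ≡ true → b ≡ true
∧-trueʳ {a} {b} = Boolₚ.∧-conicalʳ a b

∨-falseˡ : ∀ {a b} → a ∨ b ≡ false → a ≡ false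
∨-falseˡ {a} {b} = Boolₚ.∨-conicalˡ a b

∨-falseʳ : ∀ {a b} → a ∨ b ≡ false → b ≡ false
∨-falseʳ {a} {b} = Boolₚ.∨-conicalʳ a b

all-∈ : (p : A → Bool) {x : A} {xs : List A} → all p xs ≡ true → x ∈ₗ xs → p x ≡ true
all-∈ p h (here refl) = ∧-trueˡ h
all-∈ p {xs = y ∷ _} h (there m) = all-∈ p (∧-trueʳ {p y} h) m

any-∈ : (p : A → Bool) {x : A} {xs : List A} → any p xs ≡ false → x ∈ₗ xs → p x ≡ false
any-∈ p h (here refl) = ∨-falseˡ h
any-∈ p {xs = y ∷ _} h (there m) = any-∈ p (∨-falseʳ {p y} h) m

any-witness : (p : A → Bool) (xs : List A) → any p xs ≡ true → ∃[ x ] x ∈ₗ xs × p x ≡ true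
any-witness p (x ∷ xs) h with p x in eq
... | true  = x , here refl , eq
... | false with any-witness p xs h
...   | y , m , q = y , there m , q

any-cong : {p q : A → Bool} (xs : List A) → (∀ {x} → x ∈ₗ xs → p x ≡ q x) → any p xs ≡ any q xs
any-cong [] h = refl
any-cong (x ∷ xs) h = cong₂ _∨_ (h (here refl)) (any-cong xs (h ∘ there))

count : (A → Bool) → List A → ℕ
count p xs = length (filterᵇ p xs)

count-∷ : (p : A → Bool) (x : A) (xs : List A) → count p (x ∷ xs) ≡ (if p x then 1 else 0) + count p xs
count-∷ p x xs with p x
... | true  = refl
... | false = refl

count-cong : {p q : A → Bool} → (∀ x → p x ≡ q x) → (xs : List A) → count p xs ≡ count q xs
count-cong h [] = refl
count-cong {p = p} {q} h (x ∷ xs) = begin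
  count p (x ∷ xs)                       ≡⟨ count-∷ p x xs ⟩
  (if p x then 1 else 0) + count p xs    ≡⟨ cong₂ (λ b k → (if b then 1 else 0) + k) (h x) (count-cong h xs) ⟩
  (if q x then 1 else 0) + count q xs    ≡⟨ count-∷ q x xs ⟨
  count q (x ∷ xs)                       ∎
  where open ≡-Reasoning

count-++ : (p : A → Bool) (xs ys : List A) → count p (xs ++ ys) ≡ count p xs + count p ys
count-++ p [] ys = refl
count-++ p (x ∷ xs) ys with p x
... | true  = cong suc (count-++ p xs ys)
... | false = count-++ p xs ys

count-map : (p : A′ → Bool) (f : A → A′) (xs : List A) → count p (map f xs) ≡ count (p ∘ f) xs
count-map p f [] = refl
count-map p f (x ∷ xs) with p (f x)
... | true  = cong suc (count-map p f xs)
... | false = count-map p f xs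

count-filter : (p q : A → Bool) (xs : List A) → count p (filterᵇ q xs) ≡ count (λ x → q x ∧ p x) xs
count-filter p q [] = refl
count-filter p q (x ∷ xs) with q x
... | false = count-filter p q xs
... | true with p x
...   | true  = cong suc (count-filter p q xs)
...   | false = count-filter p q xs

count-split : (p q : A → Bool) (xs : List A) →
  count (λ x → p x ∧ q x) xs + count (λ x → p x ∧ not (q x)) xs ≡ count p xs
count-split p q [] = refl
count-split p q (x ∷ xs) with p x | q x
... | false | _     = count-split p q xs
... | true  | true  = cong suc (count-split p q xs)
... | true  | false = trans (+-suc _ _) (cong suc (count-split p q xs))

∈-filterᵇ⁺ : (p : A → Bool) {x : A} {xs : List A} → x ∈ₗ xs → p x ≡ true → x ∈ₗ filterᵇ p xs
∈-filterᵇ⁺ p {x} (here refl) h with p x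
∈-filterᵇ⁺ p (here refl) refl | true = here refl
∈-filterᵇ⁺ p {xs = y ∷ _} (there m) h with p y
... | true  = there (∈-filterᵇ⁺ p m h)
... | false = ∈-filterᵇ⁺ p m h

∈-filterᵇ⁻ : (p : A → Bool) {x : A} (xs : List A) → x ∈ₗ filterᵇ p xs → x ∈ₗ xs × p x ≡ true
∈-filterᵇ⁻ p (y ∷ ys) m with p y in eq
∈-filterᵇ⁻ p (y ∷ ys) (here refl) | true = here refl , eq
∈-filterᵇ⁻ p (y ∷ ys) (there m)   | true with ∈-filterᵇ⁻ p ys m
... | m′ , h = there m′ , h
∈-filterᵇ⁻ p (y ∷ ys) m | false with ∈-filterᵇ⁻ p ys m
... | m′ , h = there m′ , h

module _ {R : A → A′ → Set} where

  private
    delete : {P : A′ → Set} {ys : List A′} → Any P ys → List A′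
    delete {ys = _ ∷ ys} (here _)  = ys
    delete {ys = y ∷ _}  (there m) = y ∷ delete m

    length-delete : {P : A′ → Set} {ys : List A′} (m : Any P ys) → length ys ≡ suc (length (delete m))
    length-delete (here _)  = refl
    length-delete (there m) = cong suc (length-delete m)

    survives : {P Q : A′ → Set} {ys : List A′} (m : Any P ys) →
      (∀ y → P y → ¬ Q y) → Any Q ys → Any Q (delete m)
    survives (here p)  excl (here q)   = contradiction q (excl _ p)
    survives (here p)  excl (there m′) = m′
    survives (there m) excl (here q)   = here q
    survives (there m) excl (there m′) = there (survives m excl m′)

    survive-all : {x : A} {xs : List A} {ys : List A′} (m : Any (R x) ys) →
      All (λ x′ → ∀ y → R x y → ¬ R x′ y) xs → All (λ x′ → Any (R x′) ys) xs →
      All (λ x′ → Any (R x′) (delete m)) xs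
    survive-all m [] [] = []
    survive-all m (e ∷ es) (a ∷ as) = survives m e a ∷ survive-all m es as

  -- Delete the partner of the first element from `ys`. No later element is related to it, so all
  -- other partners survive. A relation in place of a function serves both the matching inside a bad
  -- set and the comparison of two enumerations of an orbit, where systems agree only up to `≈D`.
  pigeonhole : {xs : List A} {ys : List A′} →
    AllPairs (λ x x′ → ∀ y → R x y → ¬ R x′ y) xs →
    All (λ x → Any (R x) ys) xs → length xs ≤ length ys
  pigeonhole [] [] = z≤n
  pigeonhole {ys = ys} (d ∷ ds) (m ∷ ms) =
    subst (suc _ ≤_) (sym (length-delete m)) (s≤s (pigeonhole ds (survive-all m d ms)))

∈-allSubsets : (C : Subset n) → C ∈ₗ allSubsets n
∈-allSubsets {zero} [] = here refl
∈-allSubsets {suc n} (b ∷ C) = go b (∈-allSubsets C)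
  where
  go : ∀ b {xs : List (Subset n)} → C ∈ₗ xs →
    (b ∷ C) ∈ₗ concatMap (λ s → (false ∷ s) ∷ (true ∷ s) ∷ []) xs
  go false (here refl) = here refl
  go true  (here refl) = there (here refl)
  go b     (there m)   = there (there (go b m))

allSubsets-check : (p : Subset n → Bool) → all p (allSubsets n) ≡ true → ∀ C → p C ≡ true
allSubsets-check p h C = all-∈ p h (∈-allSubsets C)

⊆-lookup : {T C : Subset n} → T ⊆ C → ∀ i → lookup T i ≡ true → lookup C i ≡ true
⊆-lookup T⊆C i h = []=⇒lookup (T⊆C (lookup⇒[]= i _ h))

lookup-⊆ : {T C : Subset n} → (∀ i → lookup T i ≡ true → lookup C i ≡ true) → T ⊆ C
lookup-⊆ h i∈T = lookup⇒[]= _ _ (h _ ([]=⇒lookup i∈T))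

size-delete : (S : Subset n) (i : Fin n) → lookup S i ≡ true → suc ∣ S [ i ]≔ false ∣ ≡ ∣ S ∣
size-delete (true  ∷ S) zero h = refl
size-delete (true  ∷ S) (suc i) h = cong suc (size-delete S i h)
size-delete (false ∷ S) (suc i) h = size-delete S i h

⊆-equal : {T C : Subset n} → T ⊆ C → ∣ T ∣ ≡ ∣ C ∣ → T ≡ C
⊆-equal {T = []} {[]} s h = refl
⊆-equal {T = true  ∷ T} {true  ∷ C} s h = cong (true ∷_) (⊆-equal (drop-∷-⊆ s) (suc-injective h))
⊆-equal {T = false ∷ T} {false ∷ C} s h = cong (false ∷_) (⊆-equal (drop-∷-⊆ s) h)
⊆-equal {T = true  ∷ T} {false ∷ C} s h with () ← ⊆-lookup s zero refl
⊆-equal {T = false ∷ T} {true  ∷ C} s h =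
  contradiction (subst (_≤ ∣ C ∣) h (p⊆q⇒∣p∣≤∣q∣ (drop-∷-⊆ s))) ℕₚ.1+n≰n

⊆-extend : {T C : Subset n} → T ⊆ C → ∣ C ∣ ≡ suc ∣ T ∣ → ∃[ q ] lookup T q ≡ false × C ≡ T [ q ]≔ true
⊆-extend {T = []} {[]} s ()
⊆-extend {T = true ∷ T} {false ∷ C} s h with () ← ⊆-lookup s zero refl
⊆-extend {T = true ∷ T} {true ∷ C} s h with ⊆-extend (drop-∷-⊆ s) (suc-injective h)
... | q , f , e = suc q , f , cong (true ∷_) e
⊆-extend {T = false ∷ T} {false ∷ C} s h with ⊆-extend (drop-∷-⊆ s) h
... | q , f , e = suc q , f , cong (false ∷_) e
⊆-extend {T = false ∷ T} {true ∷ C} s h =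
  zero , refl , cong (true ∷_) (sym (⊆-equal (drop-∷-⊆ s) (sym (suc-injective h))))

-- Sums over subsets and relabelling of points

module SubsetSum (M : CommutativeMonoid 0ℓ 0ℓ) where

  open CommutativeMonoid M hiding (refl; sym; trans)
  open import Algebra.Properties.CommutativeMonoid.Sum M using (sum-permute; sum-cong-≗) renaming (sum to ⨁)
  private module M = CommutativeMonoid M

  Σ[_] : (Fin n → Carrier) → Subset n → Carrier
  Σ[ f ] S = ⨁ (λ i → if lookup S i then f i else ε)

  Σ-preimage : (f : Fin n → Carrier) (π : Permutation′ n) (S : Subset n) →
    Σ[ f ] (preimage π S) ≈ Σ[ (λ i → f (π ⟨$⟩ˡ i)) ] S
  Σ-preimage f π S = M.trans (sum-permute _ (flipₚ π)) (M.reflexive (sum-cong-≗ (λ i →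
    cong (λ b → if b then f (π ⟨$⟩ˡ i) else ε)
      (trans (lookup∘tabulate _ (π ⟨$⟩ˡ i)) (cong (lookup S) (inverseʳ π))))))

  Σ-insert : (f : Fin n → Carrier) (S : Subset n) (i : Fin n) → lookup S i ≡ false →
    Σ[ f ] (S [ i ]≔ true) ≈ Σ[ f ] S ∙ f i
  Σ-insert f (false ∷ S) zero h =
    M.trans (comm _ _) (∙-congʳ (M.sym (identityˡ _)))
  Σ-insert f (b ∷ S) (suc i) h =
    M.trans (∙-congˡ (Σ-insert (f ∘ suc) S i h)) (M.sym (assoc _ _ _))

lookup-preimage : (π : Permutation′ n) (C : Subset n) (i : Fin n) →
  lookup (preimage π C) i ≡ lookup C (π ⟨$⟩ʳ i)
lookup-preimage π C i = lookup∘tabulate _ i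

preimage-cong : {π ρ : Permutation′ n} → π ≈ₚ ρ → (C : Subset n) → preimage π C ≡ preimage ρ C
preimage-cong h C = tabulate-cong (λ i → cong (lookup C) (h i))

preimage-∘ : (π ρ : Permutation′ n) (C : Subset n) → preimage π (preimage ρ C) ≡ preimage (π ∘ₚ ρ) C
preimage-∘ π ρ C = tabulate-cong (λ i → lookup-preimage ρ C (π ⟨$⟩ʳ i))

preimage-id : (C : Subset n) → preimage idₚ C ≡ C
preimage-id C = tabulate∘lookup C

preimage-flipʳ : (π : Permutation′ n) (C : Subset n) → preimage π (preimage (flipₚ π) C) ≡ C
preimage-flipʳ π C = trans (preimage-∘ π (flipₚ π) C)
  (trans (preimage-cong {π = π ∘ₚ flipₚ π} {idₚ} (λ _ → inverseˡ π) C) (preimage-id C))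

preimage-flipˡ : (π : Permutation′ n) (C : Subset n) → preimage (flipₚ π) (preimage π C) ≡ C
preimage-flipˡ π = preimage-flipʳ (flipₚ π)

open SubsetSum ℕₚ.*-1-commutativeMonoid using () renaming (Σ[_] to Π[_]; Σ-preimage to Π-preimage; Σ-insert to Π-insert)
open SubsetSum ℕₚ.+-0-commutativeMonoid using () renaming (Σ[_] to Σ₊[_]; Σ-preimage to Σ₊-preimage)

size-Σ : (S : Subset n) → ∣ S ∣ ≡ Σ₊[ (λ _ → 1) ] S
size-Σ [] = refl
size-Σ (true  ∷ S) = cong suc (size-Σ S)
size-Σ (false ∷ S) = size-Σ S

size-preimage : (π : Permutation′ n) (S : Subset n) → ∣ preimage π S ∣ ≡ ∣ S ∣
size-preimage π S = trans (size-Σ (preimage π S)) (trans (Σ₊-preimage _ π S) (sym (size-Σ S)))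

preimage-⊆ : (π : Permutation′ n) {T C : Subset n} → T ⊆ C → preimage π T ⊆ preimage π C
preimage-⊆ π {T} {C} T⊆C = lookup-⊆ λ i h → trans (lookup-preimage π C i)
  (⊆-lookup T⊆C (π ⟨$⟩ʳ i) (trans (sym (lookup-preimage π T i)) h))

≈D-sym : {𝓑 𝓒 : BlockSet n} → 𝓑 ≈D 𝓒 → 𝓒 ≈D 𝓑
≈D-sym h C = sym (h C)

≈D-trans : {𝓑 𝓒 𝓓 : BlockSet n} → 𝓑 ≈D 𝓒 → 𝓒 ≈D 𝓓 → 𝓑 ≈D 𝓓
≈D-trans h k C = trans (h C) (k C)

act-≈ : (𝓑 : BlockSet n) {π ρ : Permutation′ n} → π ≈ₚ ρ → act π 𝓑 ≈D act ρ 𝓑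
act-≈ 𝓑 {π} {ρ} h C = cong 𝓑 (preimage-cong {π = π} {ρ} h C)

act-∘ : (π ρ : Permutation′ n) (𝓑 : BlockSet n) → act ρ (act π 𝓑) ≈D act (π ∘ₚ ρ) 𝓑
act-∘ π ρ 𝓑 C = cong 𝓑 (preimage-∘ π ρ C)

act-flip : (π : Permutation′ n) {𝓑 𝓒 : BlockSet n} → act π 𝓑 ≈D 𝓒 → 𝓑 ≈D act (flipₚ π) 𝓒
act-flip π {𝓑} h C = trans (cong 𝓑 (sym (preimage-flipʳ π C))) (h (preimage (flipₚ π) C))

IsSteiner-act : {t k : ℕ} (π : Permutation′ n) {𝓑 : BlockSet n} → IsSteiner t k n 𝓑 → IsSteiner t k n (act π 𝓑)
IsSteiner-act {n} {t} π {𝓑} (sizes , covers) =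
  (λ B h → trans (sym (size-preimage π B)) (sizes (preimage π B) h)) ,
  (λ T h → existence T h , uniqueness T h)
  where
  existence : ∀ T → ∣ T ∣ ≡ t → Σ (Subset n) (λ B → act π 𝓑 B ≡ true × T ⊆ B)
  existence T h with covers (preimage π T) (trans (size-preimage π T) h)
  ... | (B , b , T⊆B) , _ = preimage (flipₚ π) B , trans (cong 𝓑 (preimage-flipʳ π B)) b ,
    λ {x} → subst (_⊆ preimage (flipₚ π) B) (preimage-flipˡ π T) (preimage-⊆ (flipₚ π) T⊆B) {x}
  uniqueness : ∀ T → ∣ T ∣ ≡ t → ∀ B B′ → act π 𝓑 B ≡ true → T ⊆ B → act π 𝓑 B′ ≡ true → T ⊆ B′ → B ≡ B′
  uniqueness T h B B′ b T⊆B b′ T⊆B′ = begin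
    B                                 ≡⟨ preimage-flipˡ π B ⟨
    preimage (flipₚ π) (preimage π B)  ≡⟨ cong (preimage (flipₚ π)) (proj₂ (covers (preimage π T) (trans (size-preimage π T) h))
                                          _ _ b (preimage-⊆ π T⊆B) b′ (preimage-⊆ π T⊆B′)) ⟩
    preimage (flipₚ π) (preimage π B′) ≡⟨ preimage-flipˡ π B′ ⟩
    B′                                ∎
    where open ≡-Reasoning

-- Steiner systems S(5,6,12) and their classification

∨-true : ∀ {a b} → a ∨ b ≡ true → a ≡ true ⊎ b ≡ true
∨-true {true}  _ = inj₁ refl
∨-true {false} h = inj₂ h

≡ᵇ-sound : ∀ {m n} → (m ≡ᵇ n) ≡ true → m ≡ n
≡ᵇ-sound {m} {n} h = ℕₚ.≡ᵇ⇒≡ m n (subst T (sym h) _)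

<ᵇ-sound : ∀ {m n} → (m <ᵇ n) ≡ true → m < n
<ᵇ-sound {m} {n} h = ℕₚ.<ᵇ⇒< m n (subst T (sym h) _)

≤ᵇ-sound : ∀ {m n} → (m ≤ᵇ n) ≡ true → m ≤ n
≤ᵇ-sound {m} {n} h = ℕₚ.≤ᵇ⇒≤ m n (subst T (sym h) _)

≡ᵇ-refl : ∀ m → (m ≡ᵇ m) ≡ true
≡ᵇ-refl zero = refl
≡ᵇ-refl (suc m) = ≡ᵇ-refl m

-- In the certificates a set of points S is written as the number Σ_{i∈S} 2^i.
decode : ℕ → Subset n
decode {zero}  k = []
decode {suc n} k = (k % 2 ≡ᵇ 1) ∷ decode (k / 2)

_∈ᵇ_ : Subset n → List (Subset n) → Bool
C ∈ᵇ K = any (λ D → does (≡-dec Boolₚ._≟_ C D)) K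

∈ᵇ-sound : {C : Subset n} (K : List (Subset n)) → (C ∈ᵇ K) ≡ true → C ∈ₗ K
∈ᵇ-sound {C = C} (D ∷ K) h with ≡-dec Boolₚ._≟_ C D
... | yes refl = here refl
... | no  _    = there (∈ᵇ-sound K h)

Contains : BlockSet n → List (Subset n) → Set
Contains 𝓑 K = ∀ {C} → C ∈ₗ K → 𝓑 C ≡ true

Contains-∷ : {𝓑 : BlockSet n} {B : Subset n} {K : List (Subset n)} → 𝓑 B ≡ true → Contains 𝓑 K → Contains 𝓑 (B ∷ K)
Contains-∷ b c (here refl) = b
Contains-∷ b c (there m)   = c m

-- Blocks sharing five points coincide, so no two blocks of an S(5,6,12) clash.
clash : Subset 12 → Subset 12 → Bool
clash B C = ∣ B ∩ C ∣ ≡ᵇ 5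

extensions : Subset n → List (Subset n)
extensions T = map (λ q → T [ q ]≔ true) (filterᵇ (not ∘ lookup T) (allFin _))

candidates : List (Subset 12) → Subset 12 → List (Subset 12)
candidates K T = filterᵇ (λ B → not (any (clash B) K)) (extensions T)

-- A block is added only when it is forced. In every other situation the list stays as it is, so
-- `deduce` is sound for any list of numbers and a certificate needs no well-formedness hypothesis.
adjoin : List (Subset 12) → List (Subset 12) → List (Subset 12)
adjoin (B ∷ []) K = B ∷ K
adjoin _        K = K

complete : Subset 12 → List (Subset 12) → List (Subset 12)
complete T K = if ∣ T ∣ ≡ᵇ 5 then adjoin (candidates K T) K else K

deduce : List ℕ → List (Subset 12) → List (Subset 12)
deduce []       K = K
deduce (T ∷ Ts) K = deduce Ts (complete (decode T) K)

lift : Permutation′ 7 → Permutation′ 12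
lift π = lift₀ (lift₀ (lift₀ (lift₀ (lift₀ π))))

lift-cong : (π ρ : Permutation′ 7) → π ≈ₚ ρ → lift π ≈ₚ lift ρ
lift-cong π ρ h =
  lift₀-cong (lift₀ (lift₀ (lift₀ (lift₀ π)))) (lift₀ (lift₀ (lift₀ (lift₀ ρ))))
  (lift₀-cong (lift₀ (lift₀ (lift₀ π))) (lift₀ (lift₀ (lift₀ ρ)))
  (lift₀-cong (lift₀ (lift₀ π)) (lift₀ (lift₀ ρ))
  (lift₀-cong (lift₀ π) (lift₀ ρ) (lift₀-cong π ρ h))))

lift-∘ : (π ρ : Permutation′ 7) → lift π ∘ₚ lift ρ ≈ₚ lift (π ∘ₚ ρ)
lift-∘ π ρ zero = refl
lift-∘ π ρ (suc zero) = refl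
lift-∘ π ρ (suc (suc zero)) = refl
lift-∘ π ρ (suc (suc (suc zero))) = refl
lift-∘ π ρ (suc (suc (suc (suc zero)))) = refl
lift-∘ π ρ (suc (suc (suc (suc (suc i))))) = refl

lift-flip : (π : Permutation′ 7) → flipₚ (lift π) ≈ₚ lift (flipₚ π)
lift-flip π zero = refl
lift-flip π (suc zero) = refl
lift-flip π (suc (suc zero)) = refl
lift-flip π (suc (suc (suc zero))) = refl
lift-flip π (suc (suc (suc (suc zero)))) = refl
lift-flip π (suc (suc (suc (suc (suc i))))) = refl

mutual
  -- In both constructors the first list names five-sets whose block is forced. `found` then gives
  -- the relabelling onto the goal as a product of transpositions, `split` the five-set whose block
  -- is to be guessed.
  data Search : Set where
    found : List ℕ → List (Fin 7 × Fin 7) → Search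
    split : List ℕ → ℕ → Cases → Search

  data Cases : Set where
    []     : Cases
    _⇒_▸_ : Fin 7 → Search → Cases → Cases

infixr 5 _⇒_▸_

through : Subset 12 → Fin 7 → Subset 12
through T y = T [ 5 ↑ʳ y ]≔ true

transpositions : List (Fin 7 × Fin 7) → Permutation′ 7
transpositions = foldr (λ (x , y) π → transpose x y ∘ₚ π) idₚ

-- Some transposition of two points y, x outside {0,…,4} turns the case
-- T ∪ {y} into the case B without changing the known blocks.
symmetric : List (Subset 12) → Subset 12 → Fin 7 → Subset 12 → Fin 7 → Bool
symmetric K T y B x = all (λ C → preimage (lift (transpose x y)) C ∈ᵇ (B ∷ K)) (through T y ∷ K)

covered : List (Subset 12) → Subset 12 → Subset 12 → Cases → Bool
covered K T B []             = false
-- The value `y` itself is among those tried. Its transposition is the identity, which accounts for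
-- the candidate that is listed literally.
covered K T B (y ⇒ _ ▸ cs) = any (symmetric K T y B) (allFin 7) ∨ covered K T B cs

module Classification (goal : List (Subset 12)) where

  mutual
    check : Search → List (Subset 12) → Bool
    check (found Ts τs) K = checkGoal (transpositions τs) (deduce Ts K)
    check (split Ts T cs) K = checkSplit (deduce Ts K) (decode T) cs

    checkGoal : Permutation′ 7 → List (Subset 12) → Bool
    checkGoal π K = all (λ C → preimage (lift π) C ∈ᵇ K) goal

    checkSplit : List (Subset 12) → Subset 12 → Cases → Bool
    checkSplit K T cs = (∣ T ∣ ≡ᵇ 5) ∧ all (λ B → covered K T B cs) (candidates K T) ∧ checkCases K T cs

    checkCases : List (Subset 12) → Subset 12 → Cases → Bool
    checkCases K T []            = true
    checkCases K T (y ⇒ s ▸ cs) = check s (through T y ∷ K) ∧ checkCases K T cs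

SteinerSystem : BlockSet 12 → Set
SteinerSystem = IsSteiner 5 6 12

module _ {𝓑 : BlockSet 12} (steiner : SteinerSystem 𝓑) where

  block-size : ∀ {B} → 𝓑 B ≡ true → ∣ B ∣ ≡ 6
  block-size {B} = proj₁ steiner B

  block-unique : ∀ {T B B′} → ∣ T ∣ ≡ 5 → 𝓑 B ≡ true → T ⊆ B → 𝓑 B′ ≡ true → T ⊆ B′ → B ≡ B′
  block-unique {T} h b T⊆B b′ T⊆B′ = proj₂ (proj₂ steiner T h) _ _ b T⊆B b′ T⊆B′

  block-extending : ∀ {T} → ∣ T ∣ ≡ 5 → ∃[ q ] lookup T q ≡ false × 𝓑 (T [ q ]≔ true) ≡ true
  block-extending {T} h with proj₂ steiner T h
  ... | (B , b , T⊆B) , _ with ⊆-extend T⊆B (trans (block-size b) (cong suc (sym h)))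
  ...   | q , q∉T , refl = q , q∉T , b

  no-clash : ∀ {B C} → 𝓑 B ≡ true → 𝓑 C ≡ true → clash B C ≡ false
  no-clash {B} {C} b c with clash B C in eq
  ... | false = refl
  ... | true with block-unique {B ∩ C} (≡ᵇ-sound eq) b (p∩q⊆p B C) c (p∩q⊆q B C)
  ...   | refl with () ← trans (sym (block-size b)) (trans (cong ∣_∣ (sym (∩-idem B))) (≡ᵇ-sound eq))

  -- The actual block through `T` clashes with no known block and so survives the filter. If it is
  -- itself known already, it meets itself in six points, which is no clash.
  candidate-exists : ∀ {K T} → Contains 𝓑 K → ∣ T ∣ ≡ 5 → ∃[ B ] B ∈ₗ candidates K T × 𝓑 B ≡ true
  candidate-exists {K} {T} c h = T [ q ]≔ true ,
    ∈-filterᵇ⁺ _ (∈-map⁺ _ (∈-filterᵇ⁺ (not ∘ lookup T) (∈-allFin q) (cong not q∉T))) (cong not (unclashed K c)) , b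
    where
    extension = block-extending h
    q = proj₁ extension
    q∉T = proj₁ (proj₂ extension)
    b = proj₂ (proj₂ extension)
    unclashed : ∀ xs → Contains 𝓑 xs → any (clash (T [ q ]≔ true)) xs ≡ false
    unclashed []       _ = refl
    unclashed (C ∷ xs) d = cong₂ _∨_ (no-clash b (d (here refl))) (unclashed xs (d ∘ there))

  adjoin-sound : ∀ {K} Bs → Contains 𝓑 K → ∃[ B ] B ∈ₗ Bs × 𝓑 B ≡ true → Contains 𝓑 (adjoin Bs K)
  adjoin-sound []           c _ = c
  adjoin-sound (_ ∷ [])     c (_ , here refl , b) = Contains-∷ {𝓑 = 𝓑} b c
  adjoin-sound (_ ∷ _ ∷ _) c _ = c

  complete-sound : ∀ {K} T → Contains 𝓑 K → Contains 𝓑 (complete T K)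
  complete-sound {K} T c with ∣ T ∣ ≡ᵇ 5 in eq
  ... | true  = adjoin-sound (candidates K T) c (candidate-exists {T = T} c (≡ᵇ-sound {∣ T ∣} eq))
  ... | false = c

  deduce-sound : ∀ Ts {K} → Contains 𝓑 K → Contains 𝓑 (deduce Ts K)
  deduce-sound []       c = c
  deduce-sound (T ∷ Ts) c = deduce-sound Ts (complete-sound (decode T) c)

module _ (goal : List (Subset 12)) where

  open Classification goal

  Relabels : BlockSet 12 → Set
  Relabels 𝓑 = ∃[ π ] Contains (act (lift π) 𝓑) goal

  Case : List (Subset 12) → Set
  Case K = ∀ {𝓑} → SteinerSystem 𝓑 → Contains 𝓑 K → Relabels 𝓑

  act-contains : ∀ {𝓑 K′ K} (τ : Permutation′ 12) → all (λ C → preimage τ C ∈ᵇ K) K′ ≡ true →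
    Contains 𝓑 K → Contains (act τ 𝓑) K′
  act-contains {K = K} τ h c m = c (∈ᵇ-sound K (all-∈ _ h m))

  mutual
    check-sound : ∀ s {K} → check s K ≡ true → Case K
    check-sound (found Ts τs) h steiner c =
      transpositions τs , λ {C} → act-contains {K = deduce Ts _} (lift (transpositions τs)) h (deduce-sound steiner Ts c) {C}
    check-sound (split Ts T cs) h steiner c =
      split-sound cs {T = decode T} h steiner (deduce-sound steiner Ts c)

    split-sound : ∀ cs {K T} → checkSplit K T cs ≡ true → Case K
    split-sound cs {K} {T} h {𝓑} steiner c =
      cases-sound cs (∧-trueʳ {all (λ B → covered K T B cs) (candidates K T)} {checkCases K T cs} h′)
        (all-∈ (λ B → covered K T B cs) {xs = candidates K T} (∧-trueˡ {b = checkCases K T cs} h′) (proj₁ (proj₂ candidate)))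
        steiner (Contains-∷ {𝓑 = 𝓑} (proj₂ (proj₂ candidate)) c)
      where
      candidate = candidate-exists steiner {T = T} c (≡ᵇ-sound {∣ T ∣} (∧-trueˡ {∣ T ∣ ≡ᵇ 5} h))
      h′ = ∧-trueʳ {∣ T ∣ ≡ᵇ 5} h

    cases-sound : ∀ cs {K T B} → checkCases K T cs ≡ true → covered K T B cs ≡ true → Case (B ∷ K)
    cases-sound (y ⇒ s ▸ cs) {K} {T} {B} h k steiner c with ∨-true k
    ... | inj₁ k₁ = symmetric-sound {K} {T} {B} y (check-sound s (∧-trueˡ h)) k₁ steiner c
    ... | inj₂ k₂ = cases-sound cs (∧-trueʳ {check s (through T y ∷ K)} h) k₂ steiner c

    -- The transposed system is again Steiner and contains the blocks of case `y`. A relabelling of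
    -- it, preceded by the transposition, relabels the original, so one representative per class of
    -- cases is enough.
    symmetric-sound : ∀ {K T B} y → Case (through T y ∷ K) → any (symmetric K T y B) (allFin 7) ≡ true → Case (B ∷ K)
    symmetric-sound {K} {T} {B} y case-y k {𝓑} steiner c = τ ∘ₚ proj₁ relabelled , λ {C} m →
      trans (sym (act-≈ 𝓑 {lift τ ∘ₚ lift π} {lift (τ ∘ₚ π)} (lift-∘ τ π) C))
        (trans (sym (act-∘ (lift τ) (lift π) 𝓑 C)) (proj₂ relabelled m))
      where
      witness = any-witness (symmetric K T y B) (allFin 7) k
      τ = transpose (proj₁ witness) y
      relabelled = case-y (IsSteiner-act (lift τ) steiner)
        (λ {C} → act-contains {𝓑} {through T y ∷ K} {B ∷ K} (lift τ) (proj₂ (proj₂ witness)) c {C})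
      π = proj₁ relabelled

-- The shuffle numbering

-- Five of the eleven 6-sets with element sum 21, the least sum allowed in the hexad game. Moves
-- lower the sum, so these positions have no move inside the game and are P-positions.
generators : List (Subset 12)
generators = map decode
  (2079 ∷ 343 ∷ 591 ∷ 315 ∷ 189 ∷ [])

-- Up to relabelling 5,…,11, the blocks through 01234, 01236, 01246, 01238 have only one choice;
-- 01247, 01346 and 02346 then leave six cases, all isomorphic.
search : Search
search =
  (split [] 31 (
   # 0 ⇒
    (split [] 79 (
     # 2 ⇒
      (split [] 87 (
       # 3 ⇒
        (split [] 271 (
         # 4 ⇒
          (split [] 151 (
           # 4 ⇒
            -- A split with no cases: {0,1,2,3,10,11} is forced, and then every extension of
            -- {0,1,2,4,10} clashes with a known block, so the branch is contradictory.
            (split (1039 ∷ []) 1047 []) ▸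
           # 5 ⇒
            (split [] 91 (
             # 4 ⇒
              (split (1039 ∷ 535 ∷ 2119 ∷ 583 ∷ 551 ∷ 295 ∷ 391 ∷ 1051 ∷ 155 ∷ 1099 ∷ 171 ∷ 555 ∷
                331 ∷ 651 ∷ 115 ∷ 1107 ∷ 1075 ∷ 307 ∷ 403 ∷ 355 ∷ 1187 ∷ 451 ∷ 707 ∷ 1795 ∷ []) 93
                (
               # 5 ⇒
                (found (2077 ∷ []) ((# 0 , # 6) ∷ (# 1 , # 4) ∷ (# 2 , # 1) ∷ (# 3 , # 0) ∷
                  (# 2 , # 5) ∷ (# 2 , # 3) ∷ [])) ▸
               # 6 ⇒
                (found (285 ∷ 541 ∷ []) ((# 0 , # 6) ∷ (# 2 , # 4) ∷ (# 5 , # 0) ∷ [])) ▸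
               [])) ▸
             # 5 ⇒
              (split (1039 ∷ 535 ∷ 2119 ∷ 583 ∷ 551 ∷ 295 ∷ 391 ∷ 539 ∷ 283 ∷ 331 ∷ 587 ∷ 555 ∷
                171 ∷ 395 ∷ 1075 ∷ 595 ∷ 179 ∷ 211 ∷ 787 ∷ 227 ∷ 803 ∷ 451 ∷ 1347 ∷ 1667 ∷ []) 93
                (
               # 4 ⇒
                (found [] ((# 0 , # 6) ∷ (# 1 , # 2) ∷ (# 1 , # 3) ∷ (# 1 , # 5) ∷ (# 4 , # 0) ∷
                  [])) ▸
               # 6 ⇒
                (found (157 ∷ []) ((# 0 , # 6) ∷ (# 1 , # 5) ∷ (# 2 , # 0) ∷ (# 3 , # 2) ∷
                  (# 4 , # 3) ∷ (# 1 , # 4) ∷ [])) ▸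
               [])) ▸
             # 6 ⇒
              (split (1039 ∷ 535 ∷ 2119 ∷ 583 ∷ 551 ∷ 295 ∷ 391 ∷ 587 ∷ 1067 ∷ 299 ∷ 331 ∷ 283 ∷
                539 ∷ 651 ∷ 307 ∷ 595 ∷ 115 ∷ 179 ∷ 1299 ∷ 227 ∷ 1571 ∷ 1219 ∷ 835 ∷ 899 ∷ []) 93
                (
               # 4 ⇒
                (found (157 ∷ []) ((# 0 , # 6) ∷ (# 1 , # 3) ∷ [])) ▸
               # 5 ⇒
                (found [] ((# 0 , # 6) ∷ (# 1 , # 0) ∷ (# 2 , # 5) ∷ (# 3 , # 4) ∷ (# 3 , # 1) ∷
                  [])) ▸
               [])) ▸
             [])) ▸
           [])) ▸
         [])) ▸
       [])) ▸
     [])) ▸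
   []))

-- One five-set for each of the 127 blocks other than the generators, ordered so that a single
-- candidate is left when its turn comes.
deductions : List ℕ
deductions =
  (47 ∷ 143 ∷ 55 ∷ 151 ∷ 295 ∷ 1095 ∷ 647 ∷ 775 ∷ 779 ∷ 1291 ∷ 3083 ∷ 787 ∷ 1299 ∷ 2579 ∷ 803 ∷
  1315 ∷ 1571 ∷ 451 ∷ 707 ∷ 93 ∷ 285 ∷ 301 ∷ 557 ∷ 205 ∷ 653 ∷ 1293 ∷ 117 ∷ 309 ∷ 213 ∷ 405 ∷
  1557 ∷ 613 ∷ 421 ∷ 1189 ∷ 453 ∷ 837 ∷ 121 ∷ 1081 ∷ 2137 ∷ 409 ∷ 665 ∷ 1561 ∷ 1129 ∷ 2153 ∷ 425 ∷
  681 ∷ 809 ∷ 457 ∷ 1609 ∷ 369 ∷ 1137 ∷ 689 ∷ 2225 ∷ 817 ∷ 1233 ∷ 849 ∷ 737 ∷ 1377 ∷ 1921 ∷ 62 ∷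
  158 ∷ 286 ∷ 174 ∷ 302 ∷ 206 ∷ 334 ∷ 1550 ∷ 182 ∷ 1078 ∷ 214 ∷ 598 ∷ 790 ∷ 358 ∷ 2150 ∷ 678 ∷
  454 ∷ 1414 ∷ 186 ∷ 570 ∷ 602 ∷ 1114 ∷ 410 ∷ 234 ∷ 618 ∷ 1322 ∷ 714 ∷ 906 ∷ 242 ∷ 370 ∷ 818 ∷
  466 ∷ 1682 ∷ 1250 ∷ 930 ∷ 1858 ∷ 316 ∷ 572 ∷ 220 ∷ 604 ∷ 1180 ∷ 236 ∷ 1132 ∷ 428 ∷ 844 ∷ 908 ∷
  244 ∷ 372 ∷ 692 ∷ 1364 ∷ 916 ∷ 484 ∷ 1828 ∷ 1732 ∷ 248 ∷ 376 ∷ 440 ∷ 728 ∷ 1816 ∷ 872 ∷ 1704 ∷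
  1480 ∷ 1648 ∷ 1456 ∷ 976 ∷ 992 ∷ 103 ∷ 91 ∷ [])

opaque
  search-succeeds : Classification.check generators search [] ≡ true
  search-succeeds = refl

-- A set C of points is encoded by Π_{i∈C} 2^(2^i) = 2^(Σ_{i∈C} 2^i), and a family of sets by
-- the sum N of the codes of its members: C belongs to the family iff N / code(C) is odd.
-- Relabelling the points permutes the factors, so each of the 5040 systems is tested with
-- a few multiplications and one division of built-in naturals.
square : ℕ → ℕ
square k = k * k

weight : ∀ {n} → Fin n → ℕ
weight zero    = 2
weight (suc i) = square (weight i)

bit : ℕ → ℕ → Bool
bit N zero      = false
bit N k@(suc _) = (N / k) % 2 ≡ᵇ 1

hexad : ℕ → Subset 12 → Bool
hexad N C = bit N (Π[ weight ] C)

exactly : List (Subset 12) → ℕ → Subset 12 → Bool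
exactly blocks N C =
  if ∣ C ∣ ≡ᵇ 6
  then (if hexad N C then C ∈ᵇ blocks else any (clash C) blocks)
  else not (hexad N C)

-- The recursion that characterizes the P-positions, with the descent that makes it well-founded.
kernel : ℕ → Subset 12 → Bool
kernel N C =
  if inH C
  then does (hexad N C Boolₚ.≟ not (any (hexad N) (moves C))) ∧ descends (sumS C) (moves C)
  else not (hexad N C)
  where
  descends : ℕ → List (Subset 12) → Bool
  descends s = all (λ Q → sumS Q <ᵇ s)

closed : ℕ → Subset 12 → Bool
closed N C = does (inPbar 6 (hexad N) C Boolₚ.≟ inH C)

checks : List (Subset 12) → ℕ → Subset 12 → Bool
checks blocks N C = exactly blocks N C ∧ kernel N C ∧ closed N C

allChecks : List (Subset 12) → ℕ → Bool
allChecks blocks N = all (checks blocks N) (allSubsets 12)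

opaque
  blocks : List (Subset 12)
  blocks = deduce deductions generators

  table : ℕ
  table = sum (map Π[ weight ] blocks)

  blocks-deduced : ∀ {𝓑} → SteinerSystem 𝓑 → Contains 𝓑 generators → Contains 𝓑 blocks
  blocks-deduced steiner c = deduce-sound steiner deductions {generators} c

  checks-succeed : allChecks blocks table ≡ true
  checks-succeed = refl

if-true : ∀ b {x y} → b ≡ true → (if b then x else y) ≡ true → x ≡ true
if-true true _ h = h

if-false : ∀ b {x y} → b ≡ false → (if b then x else y) ≡ true → y ≡ true
if-false false _ h = h

does-≟ : ∀ {a b} → does (a Boolₚ.≟ b) ≡ true → a ≡ b
does-≟ {true}  {true}  _ = refl
does-≟ {false} {false} _ = refl

module _ (C : Subset 12) where

  private
    checked : checks blocks table C ≡ true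
    checked = allSubsets-check (checks blocks table) checks-succeed C

  exactly-holds : exactly blocks table C ≡ true
  exactly-holds = ∧-trueˡ {exactly blocks table C} checked

  private
    checked′ : kernel table C ∧ closed table C ≡ true
    checked′ = ∧-trueʳ {exactly blocks table C} checked

  kernel-holds : kernel table C ≡ true
  kernel-holds = ∧-trueˡ {kernel table C} checked′

  closed-holds : inPbar 6 (hexad table) C ≡ inH C
  closed-holds = does-≟ (∧-trueʳ {kernel table C} checked′)

-- The deduced blocks all lie in 𝓑, and `exactly` shows that any other 6-set meets one of them in
-- five points. Hence the five generators determine the whole system.
steiner≈hexad : ∀ {𝓑} → SteinerSystem 𝓑 → Contains 𝓑 generators → 𝓑 ≈D hexad table
steiner≈hexad {𝓑} steiner c C = Boolₚ.⇔→≡ {z = true} (mk⇔ block→hexad hexad→block)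
  where
  size-test = ∣ C ∣ ≡ᵇ 6
  contains = blocks-deduced {𝓑} steiner c

  hexad→block : hexad table C ≡ true → 𝓑 C ≡ true
  hexad→block h = contains (∈ᵇ-sound blocks (if-true (hexad table C) h (if-true size-test size (exactly-holds C))))
    where
    size : size-test ≡ true
    size = trans (sym (Boolₚ.not-involutive _)) (cong not (Boolₚ.¬-not λ e →
      Boolₚ.not-¬ h (Boolₚ.not-injective (if-false size-test (Boolₚ.not-injective e) (exactly-holds C)))))

  block→hexad : 𝓑 C ≡ true → hexad table C ≡ true
  block→hexad b = trans (sym (Boolₚ.not-involutive _)) (cong not (Boolₚ.¬-not λ e → clashing (Boolₚ.not-injective e)))
    where
    clashing : ¬ (hexad table C ≡ false)
    clashing e with any-witness (clash C) blocks (if-false (hexad table C) e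
      (if-true size-test (cong (_≡ᵇ 6) (block-size steiner b)) (exactly-holds C)))
    ... | B , B∈ , cl = Boolₚ.not-¬ cl (no-clash steiner b (contains B∈))

-- Unfolding `isPfuel` would repeat positions along every line of play. Instead the recursion is
-- verified locally by `kernel` at each set, and induction on the fuel identifies its solution with
-- the table. Any sufficient fuel is allowed because the moves of `C` inherit more than their own
-- sum.
outcome : ∀ n C → sumS C ≤ n → inH C ∧ isPfuel n C ≡ hexad table C
outcome n C = go n (inH C) refl
  where
  go : ∀ n b → inH C ≡ b → sumS C ≤ n → b ∧ isPfuel n C ≡ hexad table C
  go n false e _ = sym (Boolₚ.not-injective (if-false (inH C) e (kernel-holds C)))
  -- Positions of ℋ have sum at least 21, so the fuel cannot be exhausted at one of them.
  go zero true e s = contradiction (ℕₚ.≤-trans (≤ᵇ-sound (∧-trueʳ {∣ C ∣ ≡ᵇ 6} e)) s) λ ()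
  go (suc n) true e s = trans
    (cong not (any-cong (moves C) λ {Q} m → outcome n Q (s≤s⁻¹ (ℕₚ.<-≤-trans (smaller m) s))))
    (sym (does-≟ (∧-trueˡ {does (hexad table C Boolₚ.≟ not (any (hexad table) (moves C)))} in-kernel)))
    where
    in-kernel = if-true (inH C) e (kernel-holds C)
    smaller : ∀ {Q} → Q ∈ₗ moves C → sumS Q < sumS C
    smaller m = <ᵇ-sound (all-∈ (λ Q → sumS Q <ᵇ sumS C)
      (∧-trueʳ {does (hexad table C Boolₚ.≟ not (any (hexad table) (moves C)))} in-kernel) m)

Dsh≈hexad : Dsh ≈D hexad table
Dsh≈hexad C = outcome (sumS C) C ℕₚ.≤-refl

inPbar-cong : (k : ℕ) {𝓑 𝓒 : BlockSet 12} → 𝓑 ≈D 𝓒 → ∀ R → inPbar k 𝓑 R ≡ inPbar k 𝓒 R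
inPbar-cong k h R = cong₂ (λ a b → (∣ R ∣ ≡ᵇ k) ∧ (a ∨ b)) (h R) (any-cong (moves R) λ _ → h _)

inPbar-Dsh : ∀ R → inPbar 6 Dsh R ≡ inH R
inPbar-Dsh R = trans (inPbar-cong 6 {Dsh} {hexad table} Dsh≈hexad R) (closed-holds R)

cardPbar-cong : {𝓑 𝓒 : BlockSet 12} → 𝓑 ≈D 𝓒 → cardPbar 𝓑 ≡ cardPbar 𝓒
cardPbar-cong h = count-cong (inPbar-cong 6 h) (allSubsets 12)

-- Stated for variables because the type checker would unfold cardPbar Dsh.
cardPbar-count : ∀ 𝓑 {p m} → (∀ R → inPbar 6 𝓑 R ≡ p R) → count p (allSubsets 12) ≡ m → cardPbar 𝓑 ≡ m
cardPbar-count 𝓑 h e = trans (count-cong h (allSubsets 12)) e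

opaque
  -- The 6-sets of sum 15 + i correspond to the partitions of i inside a 6 by 6 box; those with i ≤
  -- 5 are excluded, and 924 - (1 + 1 + 2 + 3 + 5 + 7) = 905.
  count-inH : count inH (allSubsets 12) ≡ 905
  count-inH = refl

cardPbar-Dsh : cardPbar Dsh ≡ 905
cardPbar-Dsh = cardPbar-count Dsh {inH} {905} inPbar-Dsh count-inH

relabel-to-Dsh : ∀ {𝓑} → SteinerSystem 𝓑 → ∃[ π ] act (lift π) 𝓑 ≈D Dsh
relabel-to-Dsh {𝓑} steiner = π , ≈D-trans {𝓑 = act (lift π) 𝓑} {hexad table} {Dsh}
  (steiner≈hexad (IsSteiner-act (lift π) steiner) (proj₂ relabelled)) (≈D-sym {𝓑 = Dsh} {hexad table} Dsh≈hexad)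
  where
  relabelled = check-sound generators search {[]} search-succeeds steiner λ ()
  π = proj₁ relabelled

-- Bad sets

moves⁺ : (R : Subset n) {p q : Fin n} → lookup R p ≡ true → lookup R q ≡ false → toℕ q < toℕ p →
  swap R p q ∈ₗ moves R
moves⁺ R {p} {q} p∈R q∉R q<p =
  ∈-concatMap⁺ _ (lose (∈-allFin p) (∈-concatMap⁺ _ (lose (∈-allFin q) allowed)))
  where
  allowed : swap R p q ∈ₗ (if lookup R p ∧ not (lookup R q) ∧ (toℕ q <ᵇ toℕ p) then swap R p q ∷ [] else [])
  allowed rewrite p∈R | q∉R with toℕ q <ᵇ toℕ p in eq
  ... | true  = here refl
  ... | false with () ← subst T eq (ℕₚ.<⇒<ᵇ q<p)

count-tabulate : (S : Subset n) (f : Fin n → A) (p : A → Bool) → (∀ i → p (f i) ≡ lookup S i) →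
  count p (List.tabulate f) ≡ ∣ S ∣
count-tabulate [] f p h = refl
count-tabulate (b ∷ S) f p h = trans (count-∷ p (f zero) (List.tabulate (f ∘ suc)))
  (trans (cong₂ (λ c k → (if c then 1 else 0) + k) (h zero) (count-tabulate S (f ∘ suc) p (h ∘ suc))) (size b))
  where
  size : ∀ b → (if b then 1 else 0) + ∣ S ∣ ≡ ∣ b ∷ S ∣
  size true  = refl
  size false = refl

-- Read from the top: no final segment has more chosen than unchosen points. For six points out of
-- twelve this says that no initial segment has more unchosen than chosen points, the form used in
-- the enumeration by `excess`.
ballot : Subset n → Bool
ballot []      = true
ballot (b ∷ R) = ballot R ∧ (∣ b ∷ R ∣ ≤ᵇ ∣ ∁ (b ∷ R) ∣)

module _ (R : Subset n) (J : Fin n → Fin n → Set)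
  (upwards : ∀ p → lookup R p ≡ true → ∃[ q ] lookup R q ≡ false × toℕ p < toℕ q × J p q)
  (injective : ∀ {p p′ q} → J p q → J p′ q → p ≡ p′) where

  matching-size : ∣ R ∣ ≤ ∣ ∁ R ∣
  matching-size = subst₂ _≤_ (count-tabulate R id (lookup R) λ _ → refl)
    (count-tabulate (∁ R) id (not ∘ lookup R) λ i → sym (lookup-map i not R))
    (pigeonhole {R = J} (AllPairs.map (λ p≢p′ q j j′ → p≢p′ (injective j j′)) (filter⁺ _ (allFin⁺ n)))
      (All.tabulate λ {p} p∈ → let q , q∉R , _ , j = upwards p (proj₂ (∈-filterᵇ⁻ (lookup R) (allFin n) p∈))
        in lose (∈-filterᵇ⁺ (not ∘ lookup R) (∈-allFin q) (cong not q∉R)) j))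

-- Partners lie above their points, so dropping the lowest point leaves a matching on the tail.
-- `matching-size` on every tail gives the ballot inequalities.
matching⇒ballot : (R : Subset n) (J : Fin n → Fin n → Set) →
  (∀ p → lookup R p ≡ true → ∃[ q ] lookup R q ≡ false × toℕ p < toℕ q × J p q) →
  (∀ {p p′ q} → J p q → J p′ q → p ≡ p′) → ballot R ≡ true
matching⇒ballot [] J upwards injective = refl
matching⇒ballot (b ∷ R) J upwards injective =
  cong₂ _∧_ (matching⇒ballot R (λ p q → J (suc p) (suc q)) upwards′ (λ j j′ → Finₚ.suc-injective (injective j j′)))
    (≤ᵇ-complete (matching-size (b ∷ R) J upwards injective))
  where
  ≤ᵇ-complete : ∀ {m n} → m ≤ n → (m ≤ᵇ n) ≡ true
  ≤ᵇ-complete {m} {n} h with m ≤ᵇ n | ℕₚ.≤⇒≤ᵇ h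
  ... | true | _ = refl
  upwards′ : ∀ p → lookup R p ≡ true → ∃[ q ] lookup R q ≡ false × toℕ p < toℕ q × J (suc p) (suc q)
  upwards′ p p∈R with upwards (suc p) p∈R
  ... | suc q , q∉R , p<q , j = q , q∉R , s<s⁻¹ p<q , j

swap-∋ : (R : Subset n) {p q i : Fin n} → i ≢ p → lookup R i ≡ true → lookup (swap R p q) i ≡ true
swap-∋ R {p} {q} {i} i≢p i∈R with i Fin.≟ q
... | yes refl = lookup∘update i (R [ p ]≔ false) true
... | no i≢q   = trans (lookup∘update′ i≢q (R [ p ]≔ false) true) (trans (lookup∘update′ i≢p R false) i∈R)

swap-∌ : (R : Subset n) {p q : Fin n} → p ≢ q → lookup (swap R p q) p ≡ false
swap-∌ R {p} p≢q = trans (lookup∘update′ p≢q (R [ p ]≔ false) true) (lookup∘update p R false)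

bad : BlockSet 12 → Subset 12 → Bool
bad 𝓑 R = not (any 𝓑 (R ∷ moves R))

module BadSet {𝓑 : BlockSet 12} (steiner : SteinerSystem 𝓑) (R : Subset 12)
  (six : ∣ R ∣ ≡ 6) (not-near : any 𝓑 (R ∷ moves R) ≡ false) where

  Match : Fin 12 → Fin 12 → Set
  Match p q = lookup R p ≡ true × lookup R q ≡ false × 𝓑 (swap R p q) ≡ true

  upwards : ∀ p → lookup R p ≡ true → ∃[ q ] lookup R q ≡ false × toℕ p < toℕ q × Match p q
  upwards p p∈R = q , q∉R , p<q , p∈R , q∉R , block
    where
    extension = block-extending steiner {R [ p ]≔ false} (ℕₚ.suc-injective (trans (size-delete R p p∈R) six))
    q = proj₁ extension
    block = proj₂ (proj₂ extension)
    q≢p : q ≢ p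
    q≢p e = Boolₚ.not-¬ block (trans (cong 𝓑 restored) (∨-falseˡ not-near))
      where
      restored : swap R p q ≡ R
      restored = trans (cong (swap R p) e) (trans ([]≔-idempotent R p)
        (trans (cong (R [ p ]≔_) (sym p∈R)) ([]≔-lookup R p)))
    q∉R : lookup R q ≡ false
    q∉R = trans (sym (lookup∘update′ q≢p R false)) (proj₁ (proj₂ extension))
    p<q : toℕ p < toℕ q
    p<q with Finₚ.<-cmp p q
    ... | tri< p<q _ _ = p<q
    ... | tri≈ _ p≡q _ = contradiction (sym p≡q) q≢p
    ... | tri> _ _ q<p = contradiction (any-∈ 𝓑 (∨-falseʳ {𝓑 R} not-near) (moves⁺ R p∈R q∉R q<p)) (Boolₚ.not-¬ block)

  injective : ∀ {p p′ q} → Match p q → Match p′ q → p ≡ p′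
  injective {p} {p′} {q} (p∈R , q∉R , b) (p′∈R , _ , b′) with p Fin.≟ p′
  ... | yes e = e
  ... | no p≢p′ = contradiction
    (trans (cong (λ B → lookup B p′) same) (swap-∌ R {p′} {q} λ { refl → Boolₚ.not-¬ p′∈R q∉R }))
    (Boolₚ.not-¬ p′∈B)
    where
    B T′ : Subset 12
    B = swap R p q
    T′ = B [ p′ ]≔ false
    p′∈B : lookup B p′ ≡ true
    p′∈B = swap-∋ R (p≢p′ ∘ sym) p′∈R
    p∉T′ : ∀ {i} → lookup T′ i ≡ true → i ≢ p′
    p∉T′ h refl = Boolₚ.not-¬ h (lookup∘update p′ B false)
    T′⊆B : ∀ i → lookup T′ i ≡ true → lookup B i ≡ true
    T′⊆B i h = trans (sym (lookup∘update′ (p∉T′ {i} h) B false)) h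
    T′⊆B′ : ∀ i → lookup T′ i ≡ true → lookup (swap R p′ q) i ≡ true
    T′⊆B′ i h with i Fin.≟ q
    ... | yes refl = lookup∘update i (R [ p′ ]≔ false) true
    ... | no i≢q = trans (lookup∘update′ i≢q (R [ p′ ]≔ false) true) (trans (lookup∘update′ (p∉T′ {i} h) R false) i∈R)
      where
      i∈B = trans (sym (lookup∘update′ i≢q (R [ p ]≔ false) true)) (T′⊆B i h)
      i∈R : lookup R i ≡ true
      i∈R with i Fin.≟ p
      ... | yes refl = contradiction (lookup∘update p R false) (Boolₚ.not-¬ i∈B)
      ... | no i≢p   = trans (sym (lookup∘update′ i≢p R false)) i∈B
    same : B ≡ swap R p′ q
    same = block-unique steiner {T′} (ℕₚ.suc-injective (trans (size-delete B p′ p′∈B) (block-size steiner b)))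
      b (lookup-⊆ T′⊆B) b′ (lookup-⊆ T′⊆B′)

  bad⇒ballot : ballot R ≡ true
  bad⇒ballot = matching⇒ballot R Match upwards injective

size6 : Subset 12 → Bool
size6 R = ∣ R ∣ ≡ᵇ 6

ballots : List (Subset 12)
ballots = filterᵇ (λ R → size6 R ∧ ballot R) (allSubsets 12)

opaque
  count-size6 : count size6 (allSubsets 12) ≡ 924
  count-size6 = refl

count-filter-superfluous : (p q r : A → Bool) (xs : List A) →
  (∀ x → p x ≡ true → r x ≡ true → q x ≡ true) →
  count (λ x → p x ∧ r x) xs ≡ count r (filterᵇ (λ x → p x ∧ q x) xs)
count-filter-superfluous p q r xs h =
  trans (count-cong pointwise xs) (sym (count-filter r (λ x → p x ∧ q x) xs))
  where
  pointwise : ∀ x → p x ∧ r x ≡ (p x ∧ q x) ∧ r x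
  pointwise x with p x | r x | q x | h x
  ... | false | _     | _     | _ = refl
  ... | true  | true  | true  | _ = refl
  ... | true  | true  | false | k = sym (k refl refl)
  ... | true  | false | true  | _ = refl
  ... | true  | false | false | _ = refl

card+bad : ∀ {𝓑} → SteinerSystem 𝓑 → cardPbar 𝓑 + count (bad 𝓑) ballots ≡ 924
card+bad {𝓑} steiner = trans (cong (cardPbar 𝓑 +_) (sym
    (count-filter-superfluous size6 ballot (bad 𝓑) (allSubsets 12) λ R s b →
      BadSet.bad⇒ballot steiner R (≡ᵇ-sound s) (Boolₚ.not-injective b))))
  (trans (count-split size6 (λ R → any 𝓑 (R ∷ moves R)) (allSubsets 12)) count-size6)

-- Counting bad sets over all arrangements

-- A 6-set R under construction, its points below the current one being chosen:
-- chosen minus unchosen points, points still missing, R so far, R so far with one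
-- more point below, R so far with one of its points moved down.
data State (X : Set) : Set where
  state : (excess missing : ℕ) → X → List X → List X → State X

module Growth (_·_ : X → W → X) where

  include exclude next : W → State X → List (State X)
  -- The sets in `G` lack the new point and have one extra point below it, so they are exactly the
  -- results of moving the new point down. Moves thus arise by adding points only, which for codes
  -- means multiplication without division.
  include w (state e (suc (suc k)) R G M) = state (suc e) (suc k) (R · w) (map (_· w) G) (map (_· w) M ++ G) ∷ []
  include w (state e _             R G M) = []
  -- Appending at the end lists the gaps in increasing order, as `moves` does, so a neighbourhood
  -- will equal `R ∷ moves R` even as a list.
  exclude w (state (suc e) k R G M) = state e k R (G ++ (R · w) ∷ []) M ∷ []
  exclude w (state zero    k R G M) = []
  next w s = include w s ++ exclude w s

  final : W → State X → List (List X)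
  -- With its sixth point the set is complete, and so are its moves: they reach only lower points.
  -- It can be tested before the rest of the arrangement is known.
  final w (state e 1 R G M) = ((R · w) ∷ map (_· w) M ++ G) ∷ []
  final w (state e _ R G M) = []

  collect : List (State X) → Vec W n → List (List X)
  collect ss []       = []
  collect ss (w ∷ ws) = concatMap (final w) ss ++ collect (concatMap (next w) ss) ws

-- The recursion only adds points, hence commutes with every map respecting that operation. This
-- transfers the symbolic enumeration by lists of points to the numeric one by products of weights.
module Naturality (_·_ : X → W → X) (_∙_ : Y → V → Y) (h : X → Y) (v : W → V)
  (hom : ∀ x w → h (x · w) ≡ h x ∙ v w) where

  private
    module G = Growth _·_
    module G′ = Growth _∙_

  onState : State X → State Y
  onState (state e k R G M) = state e k (h R) (map h G) (map h M)

  map-hom : ∀ w xs → map (_∙ v w) (map h xs) ≡ map h (map (_· w) xs)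
  map-hom w xs = trans (sym (Listₚ.map-∘ xs)) (trans (Listₚ.map-cong (λ x → sym (hom x w)) xs) (Listₚ.map-∘ xs))

  moved-hom : ∀ w M G → map (_∙ v w) (map h M) ++ map h G ≡ map h (map (_· w) M ++ G)
  moved-hom w M G = trans (cong (_++ map h G) (map-hom w M)) (sym (Listₚ.map-++ h (map (_· w) M) G))

  include-hom : ∀ w s → G′.include (v w) (onState s) ≡ map onState (G.include w s)
  include-hom w (state e 0             R G M) = refl
  include-hom w (state e 1             R G M) = refl
  include-hom w (state e (suc (suc k)) R G M)
    rewrite hom R w | map-hom w G | moved-hom w M G = refl

  exclude-hom : ∀ w s → G′.exclude (v w) (onState s) ≡ map onState (G.exclude w s)
  exclude-hom w (state zero    k R G M) = refl
  exclude-hom w (state (suc e) k R G M)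
    rewrite sym (hom R w) | Listₚ.map-++ h G ((R · w) ∷ []) = refl

  next-hom : ∀ w s → G′.next (v w) (onState s) ≡ map onState (G.next w s)
  next-hom w s = trans (cong₂ _++_ (include-hom w s) (exclude-hom w s))
    (sym (Listₚ.map-++ onState (G.include w s) (G.exclude w s)))

  final-hom : ∀ w s → G′.final (v w) (onState s) ≡ map (map h) (G.final w s)
  final-hom w (state e 0             R G M) = refl
  final-hom w (state e 1             R G M) rewrite hom R w | moved-hom w M G = refl
  final-hom w (state e (suc (suc k)) R G M) = refl

  concatMap-hom : {C D : Set} (f : State X → List C) (f′ : State Y → List D) (g : C → D) →
    (∀ s → f′ (onState s) ≡ map g (f s)) → ∀ ss → concatMap f′ (map onState ss) ≡ map g (concatMap f ss)
  concatMap-hom f f′ g e ss = trans (Listₚ.concatMap-map f′ onState ss)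
    (trans (Listₚ.concatMap-cong e ss) (sym (Listₚ.map-concatMap g f ss)))

  collect-hom : ∀ ss (ws : Vec W n) → G′.collect (map onState ss) (Vec.map v ws) ≡ map (map h) (G.collect ss ws)
  collect-hom ss [] = refl
  collect-hom ss (w ∷ ws) = trans (cong₂ _++_
      (concatMap-hom (G.final w) (G′.final (v w)) (map h) (final-hom w) ss)
      (trans (cong (λ ss′ → G′.collect ss′ (Vec.map v ws)) (concatMap-hom (G.next w) (G′.next (v w)) onState (next-hom w) ss))
        (collect-hom (concatMap (G.next w) ss) ws)))
    (sym (Listₚ.map-++ (map h) (concatMap (G.final w) ss) (G.collect (concatMap (G.next w) ss) ws)))

-- Comparison of the enumeration with the ballot sequences

module _ (_≟_ : DecidableEquality A) where

  withdraw : A → List A → (List A → Bool) → Bool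
  withdraw x []       k = false
  withdraw x (y ∷ ys) k = if does (x ≟ y) then k ys else withdraw x ys (λ zs → k (y ∷ zs))

  permuted : List A → List A → Bool
  permuted []       []      = true
  permuted []       (_ ∷ _) = false
  permuted (x ∷ xs) ys      = withdraw x ys (permuted xs)

  withdraw-sound : ∀ x ys k → withdraw x ys k ≡ true → ∃[ zs ] k zs ≡ true × x ∷ zs ↭ ys
  withdraw-sound x (y ∷ ys) k h with x ≟ y
  ... | yes refl = ys , h , ↭-refl
  ... | no _ with withdraw-sound x ys (k ∘ (y ∷_)) h
  ...   | zs , h′ , e = y ∷ zs , h′ , ↭-trans (↭-swap x y ↭-refl) (↭-prep y e)

  permuted-sound : ∀ xs ys → permuted xs ys ≡ true → xs ↭ ys
  permuted-sound []       []  h = ↭-refl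
  permuted-sound (x ∷ xs) ys h with withdraw-sound x ys (permuted xs) h
  ... | zs , h′ , e = ↭-trans (↭-prep x (permuted-sound xs zs h′)) e

count-↭ : (p : A → Bool) {xs ys : List A} → xs ↭ ys → count p xs ≡ count p ys
count-↭ p e = ↭-length (filter-↭ (Boolₚ.T? ∘ p) e)

fromList : List (Fin 12) → Subset 12
fromList []      = ⊥
fromList (i ∷ l) = fromList l [ i ]≔ true

distinct : List (Fin 12) → Bool
distinct []      = true
distinct (i ∷ l) = not (lookup (fromList l) i) ∧ distinct l

productOf : (Fin 12 → ℕ) → List (Fin 12) → ℕ
productOf v []      = 1
productOf v (i ∷ l) = productOf v l * v i

Π-⊥ : (v : Fin n → ℕ) → Π[ v ] ⊥ ≡ 1
Π-⊥ {zero}  v = refl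
Π-⊥ {suc n} v = trans (ℕₚ.*-identityˡ _) (Π-⊥ (v ∘ suc))

Π-fromList : ∀ v l → distinct l ≡ true → Π[ v ] (fromList l) ≡ productOf v l
Π-fromList v []      h = Π-⊥ v
Π-fromList v (i ∷ l) h = trans (Π-insert v (fromList l) i (Boolₚ.not-injective (∧-trueˡ h)))
  (cong (_* v i) (Π-fromList v l (∧-trueʳ {not (lookup (fromList l) i)} h)))

unmet : ℕ → List ℕ → Bool
unmet N e = not (any (bit N) e)

empty : X → List (State X)
empty x = state 0 6 x [] [] ∷ []

module Symbolic = Growth {List (Fin 12)} {Fin 12} (λ l i → i ∷ l)
module Numeric  = Growth _*_

opaque
  neighbourhoods : List (List (List (Fin 12)))
  neighbourhoods = Symbolic.collect (empty []) (Vec.allFin 12)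

  neighbourhoods-distinct : all (all distinct) neighbourhoods ≡ true
  neighbourhoods-distinct = refl

  neighbourhoods-ballots : permuted (Listₚ.≡-dec (≡-dec Boolₚ._≟_))
    (map (map fromList) neighbourhoods) (map (λ R → R ∷ moves R) ballots) ≡ true
  neighbourhoods-ballots = refl

  neighbourhoods-collect : ∀ v → Numeric.collect (empty 1) (Vec.map v (Vec.allFin 12)) ≡ map (map (productOf v)) neighbourhoods
  neighbourhoods-collect v = Naturality.collect-hom (λ l i → i ∷ l) _*_ (productOf v) v (λ _ _ → refl) (empty []) (Vec.allFin 12)

count-bad : (𝓑 : BlockSet 12) (N : ℕ) (v : Fin 12 → ℕ) → (∀ C → 𝓑 C ≡ bit N (Π[ v ] C)) →
  count (bad 𝓑) ballots ≡ count (unmet N) (Numeric.collect (empty 1) (Vec.map v (Vec.allFin 12)))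
count-bad 𝓑 N v h = begin
  count (bad 𝓑) ballots                                     ≡⟨ count-map meets (λ R → R ∷ moves R) ballots ⟨
  count meets (map (λ R → R ∷ moves R) ballots)             ≡⟨ count-↭ meets {map (map fromList) neighbourhoods} {near}
      (permuted-sound _ (map (map fromList) neighbourhoods) near neighbourhoods-ballots) ⟨
  count meets (map (map fromList) neighbourhoods)           ≡⟨ translate neighbourhoods neighbourhoods-distinct ⟩
  count (unmet N) (map (map (productOf v)) neighbourhoods)  ≡⟨ cong (count (unmet N)) (neighbourhoods-collect v) ⟨
  count (unmet N) (Numeric.collect (empty 1) (Vec.map v (Vec.allFin 12))) ∎
  where
  open ≡-Reasoning
  near = map (λ R → R ∷ moves R) ballots
  meets : List (Subset 12) → Bool
  meets e = not (any 𝓑 e)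
  any-translate : ∀ e → all distinct e ≡ true → any 𝓑 (map fromList e) ≡ any (bit N) (map (productOf v) e)
  any-translate []      d = refl
  any-translate (l ∷ e) d = cong₂ _∨_
    (trans (h (fromList l)) (cong (bit N) (Π-fromList v l (∧-trueˡ d))))
    (any-translate e (∧-trueʳ {distinct l} d))
  translate : ∀ es → all (all distinct) es ≡ true →
    count meets (map (map fromList) es) ≡ count (unmet N) (map (map (productOf v)) es)
  translate []       d = refl
  translate (e ∷ es) d = begin
    count meets (map fromList e ∷ map (map fromList) es)
      ≡⟨ count-∷ meets (map fromList e) _ ⟩
    (if meets (map fromList e) then 1 else 0) + count meets (map (map fromList) es)
      ≡⟨ cong₂ (λ b k → (if not b then 1 else 0) + k) (any-translate e (∧-trueˡ d)) (translate es (∧-trueʳ {all distinct e} d)) ⟩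
    (if unmet N (map (productOf v) e) then 1 else 0) + count (unmet N) (map (map (productOf v)) es)
      ≡⟨ count-∷ (unmet N) (map (productOf v) e) _ ⟨
    count (unmet N) (map (productOf v) e ∷ map (map (productOf v)) es) ∎

-- Arrangements of the last seven points

perms : ∀ n → List (Permutation′ n)
perms zero    = idₚ ∷ []
perms (suc n) = concatMap (λ i → map (insert zero i) (perms n)) (allFin (suc n))

-- Arrangements with a common prefix share the states reached and the bad sets found so far.
mutual
  badCounts : ∀ n → ℕ → List (State ℕ) → Vec ℕ n → ℕ → List ℕ
  badCounts zero    N ss pool acc = acc ∷ []
  badCounts (suc n) N ss pool acc =
    concatMap (λ i → extend n N ss (lookup pool i) (removeAt pool i) acc) (allFin (suc n))

  extend : ∀ n → ℕ → List (State ℕ) → ℕ → Vec ℕ n → ℕ → List ℕ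
  extend n N ss w pool acc = badCounts n N (concatMap (Numeric.next w) ss) pool
    (acc + count (unmet N) (concatMap (Numeric.final w) ss))

arrange : Vec A n → Permutation′ n → Vec A n
arrange pool π = Vec.tabulate (λ k → lookup pool (π ⟨$⟩ʳ k))

lookup-removeAt : (xs : Vec A (suc n)) (i : Fin (suc n)) (k : Fin n) → lookup (removeAt xs i) k ≡ lookup xs (punchIn i k)
lookup-removeAt (x ∷ xs)     zero    k       = refl
lookup-removeAt (x ∷ y ∷ xs) (suc i) zero    = refl
lookup-removeAt (x ∷ y ∷ xs) (suc i) (suc k) = lookup-removeAt (y ∷ xs) i k

arrange-insert : (pool : Vec A (suc n)) (i : Fin (suc n)) (π : Permutation′ n) →
  arrange pool (insert zero i π) ≡ lookup pool i ∷ arrange (removeAt pool i) π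
arrange-insert pool i π = cong (lookup pool i ∷_) (tabulate-cong λ k →
  trans (cong (lookup pool) (insert-punchIn zero i π k)) (sym (lookup-removeAt pool i (π ⟨$⟩ʳ k))))

total : ℕ → List (State ℕ) → Vec ℕ n → ℕ → Permutation′ n → ℕ
total N ss pool acc π = acc + count (unmet N) (Numeric.collect ss (arrange pool π))

badCounts-correct : ∀ n N ss pool acc → badCounts n N ss pool acc ≡ map (total N ss pool acc) (perms n)
badCounts-correct zero    N ss pool acc = cong (_∷ []) (sym (ℕₚ.+-identityʳ acc))
badCounts-correct (suc n) N ss pool acc =
  trans (Listₚ.concatMap-cong branch (allFin (suc n)))
    (sym (Listₚ.map-concatMap (total N ss pool acc) (λ i → map (insert zero i) (perms n)) (allFin (suc n))))
  where
  branch : ∀ i → extend n N ss (lookup pool i) (removeAt pool i) acc ≡ map (total N ss pool acc) (map (insert zero i) (perms n))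
  branch i = trans (badCounts-correct n N (concatMap (Numeric.next w) ss) (removeAt pool i) _)
    (trans (Listₚ.map-cong pointwise (perms n)) (Listₚ.map-∘ (perms n)))
    where
    w = lookup pool i
    finals = concatMap (Numeric.final w) ss
    pointwise : ∀ π → (acc + count (unmet N) finals)
        + count (unmet N) (Numeric.collect (concatMap (Numeric.next w) ss) (arrange (removeAt pool i) π))
      ≡ total N ss pool acc (insert zero i π)
    pointwise π = trans (ℕₚ.+-assoc acc _ _) (cong (acc +_) (trans
      (sym (count-++ (unmet N) finals _))
      (cong (λ ws → count (unmet N) (Numeric.collect ss ws)) (sym (arrange-insert pool i π)))))

weights : Vec ℕ 7
weights = Vec.tabulate (λ k → weight (5 ↑ʳ k))

withFive : (Fin 12 → A) → Vec A 7 → Vec A 12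
withFive v ws = v (# 0) ∷ v (# 1) ∷ v (# 2) ∷ v (# 3) ∷ v (# 4) ∷ ws

afterFive : (Fin 12 → ℕ) → List (State ℕ)
afterFive v = foldr (λ i → concatMap (Numeric.next (v i))) (empty 1) (# 4 ∷ # 3 ∷ # 2 ∷ # 1 ∷ # 0 ∷ [])

-- A 6-set cannot be completed within the first five points, so `final` contributes nothing there
-- and only the states reached matter.
collect-withFive : ∀ v ws → Numeric.collect (empty 1) (withFive v ws) ≡ Numeric.collect (afterFive v) ws
collect-withFive v ws = refl

weights-lift : (π : Permutation′ 7) → Vec.map (λ i → weight (lift π ⟨$⟩ʳ i)) (Vec.allFin 12) ≡ withFive weight (arrange weights π)
weights-lift π = cong (withFive weight)
  (tabulate-cong {n = 7} λ k → sym (lookup∘tabulate (λ k → weight (5 ↑ʳ k)) (π ⟨$⟩ʳ k)))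

collect-lift : (π : Permutation′ 7) →
  Numeric.collect (empty 1) (Vec.map (λ i → weight (lift π ⟨$⟩ʳ i)) (Vec.allFin 12)) ≡
  Numeric.collect (afterFive weight) (arrange weights π)
collect-lift π = trans {j = Numeric.collect (empty 1) (withFive weight (arrange weights π))}
  (cong (Numeric.collect (empty 1)) {Vec.map (λ i → weight (lift π ⟨$⟩ʳ i)) (Vec.allFin 12)}
    {withFive weight (arrange weights π)} (weights-lift π))
  (collect-withFive weight (arrange weights π))

-- With the inverse permutation, `C` is a block iff its image under `lift π` is a hexad of 𝓓^sh. So
-- position i simply carries the weight of its image.
relabelled : Permutation′ 7 → BlockSet 12
relabelled π = act (flipₚ (lift π)) Dsh

count-bad-relabelled : (π : Permutation′ 7) →
  count (bad (relabelled π)) ballots ≡ total table (afterFive weight) weights 0 π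
count-bad-relabelled π = trans
  (count-bad (relabelled π) table (λ i → weight (lift π ⟨$⟩ʳ i)) λ C →
    trans (Dsh≈hexad (preimage (flipₚ (lift π)) C)) (cong (bit table) (Π-preimage weight (flipₚ (lift π)) C)))
  (cong (count (unmet table)) (collect-lift π))

remainder : ∀ {m b c s} → m + b ≡ s → b ≡ c → m ≡ s ∸ c
remainder {m} {b} refl refl = sym (ℕₚ.m+n∸n≡m m b)

card-relabelled : SteinerSystem Dsh → ∀ π → cardPbar (relabelled π) ≡ 924 ∸ total table (afterFive weight) weights 0 π
card-relabelled steiner π = remainder {cardPbar (relabelled π)}
  {count (bad (relabelled π)) ballots} {total table (afterFive weight) weights 0 π} {924}
  (card+bad {relabelled π} (IsSteiner-act (flipₚ (lift π)) steiner)) (count-bad-relabelled π)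

-- Checking the distribution

entry : List (ℕ × ℕ) → ℕ → ℕ
entry []            m = 0
entry ((n , c) ∷ t) m = if m ≡ᵇ n then c else entry t m

mutual
  spend : ℕ → List (ℕ × ℕ) → (List (ℕ × ℕ) → Bool) → Bool
  spend x []            k = false
  spend x ((n , c) ∷ t) k = if x ≡ᵇ n then spendHere n c t k else spend x t (λ t′ → k ((n , c) ∷ t′))

  spendHere : ℕ → ℕ → List (ℕ × ℕ) → (List (ℕ × ℕ) → Bool) → Bool
  spendHere n zero    t k = false
  spendHere n (suc c) t k = k ((n , c) ∷ t)

-- One pass settles all multiplicities: each value uses up one unit of its entry, a value without a
-- remaining unit fails, and nothing may be left over at the end.
tally : List ℕ → List (ℕ × ℕ) → Bool
tally []       t = all (λ (_ , c) → c ≡ᵇ 0) t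
tally (x ∷ xs) t = spend x t (tally xs)

≡ᵇ-sym : ∀ m n → (m ≡ᵇ n) ≡ (n ≡ᵇ m)
≡ᵇ-sym zero    zero    = refl
≡ᵇ-sym zero    (suc n) = refl
≡ᵇ-sym (suc m) zero    = refl
≡ᵇ-sym (suc m) (suc n) = ≡ᵇ-sym m n

spend-sound : ∀ x t k → spend x t k ≡ true →
  ∃[ t′ ] k t′ ≡ true × (∀ m → entry t m ≡ (if x ≡ᵇ m then 1 else 0) + entry t′ m)
spend-sound x ((n , c) ∷ t) k h with x ≡ᵇ n in x≡n
spend-sound x ((n , suc c) ∷ t) k h | true = (n , c) ∷ t , h , correct
  where
  correct : ∀ m → entry ((n , suc c) ∷ t) m ≡ (if x ≡ᵇ m then 1 else 0) + entry ((n , c) ∷ t) m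
  correct m rewrite ≡ᵇ-sound {x} {n} x≡n | ≡ᵇ-sym m n with n ≡ᵇ m
  ... | true  = refl
  ... | false = refl
spend-sound x ((n , c) ∷ t) k h | false with spend-sound x t (λ t′ → k ((n , c) ∷ t′)) h
... | t′ , h′ , e = (n , c) ∷ t′ , h′ , correct
  where
  correct : ∀ m → entry ((n , c) ∷ t) m ≡ (if x ≡ᵇ m then 1 else 0) + entry ((n , c) ∷ t′) m
  correct m with m ≡ᵇ n in m≡n
  ... | false = e m
  ... | true rewrite ≡ᵇ-sound {m} {n} m≡n | x≡n = refl

tally-sound : ∀ xs t → tally xs t ≡ true → ∀ m → count (_≡ᵇ m) xs ≡ entry t m
tally-sound [] t h m = sym (empty-table t h)
  where
  empty-table : ∀ t → all (λ (_ , c) → c ≡ᵇ 0) t ≡ true → entry t m ≡ 0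
  empty-table []            h = refl
  empty-table ((n , c) ∷ t) h with m ≡ᵇ n
  ... | true  = ≡ᵇ-sound (∧-trueˡ h)
  ... | false = empty-table t (∧-trueʳ {c ≡ᵇ 0} h)
tally-sound (x ∷ xs) t h m with spend-sound x t (tally xs) h
... | t′ , h′ , e = trans (count-∷ (_≡ᵇ m) x xs)
  (trans (cong ((if x ≡ᵇ m then 1 else 0) +_) (tally-sound xs t′ h′ m)) (sym (e m)))

distribution : List (ℕ × ℕ)
distribution =
  (905 , 1) ∷ (906 , 10) ∷ (907 , 42) ∷ (908 , 150) ∷ (909 , 351) ∷ (910 , 650) ∷
  (911 , 1012) ∷ (912 , 1237) ∷ (913 , 939) ∷ (914 , 532) ∷ (915 , 115) ∷ (916 , 1) ∷ []

agrees : ∀ n → ℕ → List (State ℕ) → Vec ℕ n → Bool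
agrees n N ss pool = tally (map (924 ∸_) (badCounts n N ss pool 0)) distribution

-- Stated for a variable n because the type checker would evaluate all arrangements for n = 7.
count-perms : ∀ n N ss pool (f : Permutation′ n → ℕ) → (∀ π → f π ≡ 924 ∸ total N ss pool 0 π) →
  agrees n N ss pool ≡ true → ∀ m → count (λ π → f π ≡ᵇ m) (perms n) ≡ entry distribution m
count-perms n N ss pool f h e m = begin
  count (λ π → f π ≡ᵇ m) (perms n)                          ≡⟨ count-map (_≡ᵇ m) f (perms n) ⟨
  count (_≡ᵇ m) (map f (perms n))                           ≡⟨ cong (count (_≡ᵇ m)) (Listₚ.map-cong h (perms n)) ⟩
  count (_≡ᵇ m) (map ((924 ∸_) ∘ total N ss pool 0) (perms n)) ≡⟨ cong (count (_≡ᵇ m)) (Listₚ.map-∘ (perms n)) ⟩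
  count (_≡ᵇ m) (map (924 ∸_) (map (total N ss pool 0) (perms n)))
    ≡⟨ cong (λ xs → count (_≡ᵇ m) (map (924 ∸_) xs)) (badCounts-correct n N ss pool 0) ⟨
  count (_≡ᵇ m) (map (924 ∸_) (badCounts n N ss pool 0))    ≡⟨ tally-sound (map (924 ∸_) (badCounts n N ss pool 0)) distribution e m ⟩
  entry distribution m                                      ∎
  where open ≡-Reasoning

opaque
  unfolding table

  all-agree : agrees 7 table (afterFive weight) weights ≡ true
  all-agree = refl

count-relabelled : SteinerSystem Dsh → ∀ m → count (λ π → cardPbar (relabelled π) ≡ᵇ m) (perms 7) ≡ entry distribution m
count-relabelled steiner = count-perms 7 table (afterFive weight) weights (λ π → cardPbar (relabelled π)) (card-relabelled steiner) all-agree

-- The orbit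

insert-suc : ∀ (i : Fin (suc n)) (π : Permutation′ n) k → insert zero i π ⟨$⟩ʳ suc k ≡ punchIn i (π ⟨$⟩ʳ k)
insert-suc i π k = insert-punchIn zero i π k

perms-complete : ∀ n (π : Permutation′ n) → Any (π ≈ₚ_) (perms n)
perms-complete zero    π = here λ ()
perms-complete (suc n) π = Anyₚ.concat⁺ (Anyₚ.map⁺ (lose (∈-allFin (π ⟨$⟩ʳ zero))
  (Anyₚ.map⁺ (Any.map (λ {ρ} → extend-≈ {ρ}) (perms-complete n (remove zero π))))))
  where
  extend-≈ : ∀ {ρ} → remove zero π ≈ₚ ρ → π ≈ₚ insert zero (π ⟨$⟩ʳ zero) ρ
  extend-≈     h zero    = refl
  extend-≈ {ρ} h (suc k) = begin
    π ⟨$⟩ʳ suc k                                             ≡⟨ insert-remove zero π (suc k) ⟨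
    insert zero (π ⟨$⟩ʳ zero) (remove zero π) ⟨$⟩ʳ suc k      ≡⟨ insert-suc (π ⟨$⟩ʳ zero) (remove zero π) k ⟩
    punchIn (π ⟨$⟩ʳ zero) (remove zero π ⟨$⟩ʳ k)              ≡⟨ cong (punchIn (π ⟨$⟩ʳ zero)) (h k) ⟩
    punchIn (π ⟨$⟩ʳ zero) (ρ ⟨$⟩ʳ k)                          ≡⟨ insert-suc (π ⟨$⟩ʳ zero) ρ k ⟨
    insert zero (π ⟨$⟩ʳ zero) ρ ⟨$⟩ʳ suc k                    ∎
    where open ≡-Reasoning

_≉ₚ_ : Permutation′ n → Permutation′ n → Set
π ≉ₚ ρ = ¬ π ≈ₚ ρ

perms-distinct : ∀ n → AllPairs _≉ₚ_ (perms n)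
perms-distinct zero    = [] ∷ []
perms-distinct (suc n) = AllPairsₚ.concat⁺
  (Allₚ.map⁺ (All.universal same (allFin (suc n))))
  (AllPairsₚ.map⁺ (AllPairs.map different (allFin⁺ (suc n))))
  where
  same : ∀ i → AllPairs _≉ₚ_ (map (insert zero i) (perms n))
  same i = AllPairsₚ.map⁺ (AllPairs.map (λ {π} {ρ} π≉ρ e → π≉ρ λ k → Finₚ.punchIn-injective i _ _
    (trans (sym (insert-suc i π k)) (trans (e (suc k)) (insert-suc i ρ k)))) (perms-distinct n))
  different : ∀ {i j} → i ≢ j →
    All (λ π → All (π ≉ₚ_) (map (insert zero j) (perms n))) (map (insert zero i) (perms n))
  different i≢j = Allₚ.map⁺ (All.universal (λ π → Allₚ.map⁺ (All.universal (λ ρ e → i≢j (e zero)) (perms n))) (perms n))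

flipₚ-cong : (π ρ : Permutation′ n) → π ≈ₚ ρ → flipₚ π ≈ₚ flipₚ ρ
flipₚ-cong π ρ h i = begin
  π ⟨$⟩ˡ i                        ≡⟨ inverseˡ ρ ⟨
  ρ ⟨$⟩ˡ (ρ ⟨$⟩ʳ (π ⟨$⟩ˡ i))       ≡⟨ cong (ρ ⟨$⟩ˡ_) (h (π ⟨$⟩ˡ i)) ⟨
  ρ ⟨$⟩ˡ (π ⟨$⟩ʳ (π ⟨$⟩ˡ i))       ≡⟨ cong (ρ ⟨$⟩ˡ_) (inverseʳ π) ⟩
  ρ ⟨$⟩ˡ i                        ∎
  where open ≡-Reasoning

AllPairs-map : {B : Set} {P : A → A → Set} (Q : B → B → Set) (f : A → B) →
  (∀ x y → P x y → Q (f x) (f y)) → {xs : List A} → AllPairs P xs → AllPairs Q (map f xs)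
AllPairs-map Q f h ps = AllPairsₚ.map⁺ (AllPairs.map (h _ _) ps)

Any-map : {B : Set} {P : A → Set} (Q : B → Set) (f : A → B) →
  (∀ x → P x → Q (f x)) → {xs : List A} → Any P xs → Any Q (map f xs)
Any-map Q f h m = Anyₚ.map⁺ (Any.map (h _) m)

isId : Permutation′ 7 → Bool
isId π = all (λ k → does (π ⟨$⟩ʳ k Fin.≟ k)) (allFin 7)

movesHexads : ℕ → List (Subset 12) → Permutation′ 7 → Bool
movesHexads N K π = any (λ B → not (hexad N (preimage (lift π) B))) K

-- Testing the generators alone loses nothing: a permutation under which all five have hexads as
-- preimages yields a system containing the generators, hence 𝓓^sh again.
rigid : ℕ → List (Subset 12) → List (Permutation′ 7) → Bool
rigid N K ps = all (λ π → isId π ∨ movesHexads N K π) ps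

opaque
  unfolding table

  rigid-perms : rigid table generators (perms 7) ≡ true
  rigid-perms = refl

  generators-hexads : all (hexad table) generators ≡ true
  generators-hexads = refl

  length-perms : length (perms 7) ≡ 5040
  length-perms = refl

isId-sound : (π : Permutation′ 7) → isId π ≡ true → π ≈ₚ idₚ
isId-sound π h k with all-∈ (λ k → does (π ⟨$⟩ʳ k Fin.≟ k)) h (∈-allFin k)
... | e with π ⟨$⟩ʳ k Fin.≟ k
...   | yes πk≡k = πk≡k

-- The permutations and the facts computed about them enter as hypotheses, so that the list of all
-- 5040 stays unevaluated in the orbit argument.
module Orbit (ps : List (Permutation′ 7)) (distinctPs : AllPairs _≉ₚ_ ps)
  (completePs : ∀ π → Any (π ≈ₚ_) ps) (K : List (Subset 12)) (hexads : all (hexad table) K ≡ true)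
  (rigidPs : rigid table K ps ≡ true) where

  stabilizer-trivial : ∀ π → act (lift π) Dsh ≈D Dsh → π ≈ₚ idₚ
  stabilizer-trivial π fixes k = trans (π≈ρ k) (ρ≈id k)
    where
    member = find (completePs π)
    ρ = proj₁ member
    ρ∈ps = proj₁ (proj₂ member)
    π≈ρ = proj₂ (proj₂ member)
    unmoved : movesHexads table K ρ ≡ false
    unmoved = Boolₚ.¬-not λ h → let B , B∈ , nonhexad = any-witness (λ B → not (hexad table (preimage (lift ρ) B))) K h in
      Boolₚ.not-¬ (all-∈ (hexad table) hexads B∈) (trans (sym (hexads-fixed B)) (Boolₚ.not-injective nonhexad))
      where
      hexads-fixed : ∀ B → hexad table (preimage (lift ρ) B) ≡ hexad table B
      hexads-fixed B = begin
        hexad table (preimage (lift ρ) B) ≡⟨ Dsh≈hexad (preimage (lift ρ) B) ⟨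
        act (lift ρ) Dsh B                ≡⟨ act-≈ Dsh {lift π} {lift ρ} (lift-cong π ρ π≈ρ) B ⟨
        act (lift π) Dsh B                ≡⟨ fixes B ⟩
        Dsh B                             ≡⟨ Dsh≈hexad B ⟩
        hexad table B                     ∎
        where open ≡-Reasoning
    ρ≈id : ρ ≈ₚ idₚ
    ρ≈id with ∨-true {isId ρ} (all-∈ (λ π → isId π ∨ movesHexads table K π) rigidPs ρ∈ps)
    ... | inj₁ h = isId-sound ρ h
    ... | inj₂ h = contradiction unmoved (Boolₚ.not-¬ h)

  relabelled-injective : ∀ π ρ → relabelled π ≈D relabelled ρ → π ≈ₚ ρ
  relabelled-injective π ρ same k = begin
    π ⟨$⟩ʳ k                            ≡⟨ stabilizer-trivial (flipₚ π ∘ₚ ρ) fixes (π ⟨$⟩ʳ k) ⟨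
    ρ ⟨$⟩ʳ (π ⟨$⟩ˡ (π ⟨$⟩ʳ k))           ≡⟨ cong (ρ ⟨$⟩ʳ_) (inverseˡ π) ⟩
    ρ ⟨$⟩ʳ k                            ∎
    where
    open ≡-Reasoning
    composite : flipₚ (lift π) ∘ₚ lift ρ ≈ₚ lift (flipₚ π ∘ₚ ρ)
    composite i = trans (cong (lift ρ ⟨$⟩ʳ_) (lift-flip π i)) (lift-∘ (flipₚ π) ρ i)
    fixes : act (lift (flipₚ π ∘ₚ ρ)) Dsh ≈D Dsh
    fixes C = begin
      act (lift (flipₚ π ∘ₚ ρ)) Dsh C      ≡⟨ act-≈ Dsh {flipₚ (lift π) ∘ₚ lift ρ} {lift (flipₚ π ∘ₚ ρ)} composite C ⟨
      act (flipₚ (lift π) ∘ₚ lift ρ) Dsh C ≡⟨ act-∘ (flipₚ (lift π)) (lift ρ) Dsh C ⟨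
      act (lift ρ) (relabelled π) C        ≡⟨ same (preimage (lift ρ) C) ⟩
      act (lift ρ) (relabelled ρ) C        ≡⟨ cong Dsh (preimage-flipˡ (lift ρ) C) ⟩
      Dsh C                                ∎

  module Labels (𝓑 : BlockSet 12) (σ : Permutation′ 12) (σ𝓑 : act σ 𝓑 ≈D Dsh) where

    label : Permutation′ 7 → Permutation′ 12
    label π = σ ∘ₚ flipₚ (lift π)

    act-label : ∀ π → act (label π) 𝓑 ≈D relabelled π
    act-label π C = trans (sym (act-∘ σ (flipₚ (lift π)) 𝓑 C)) (σ𝓑 (preimage (flipₚ (lift π)) C))

    label-injective : ∀ π ρ → act (label π) 𝓑 ≈D act (label ρ) 𝓑 → π ≈ₚ ρ
    label-injective π ρ same = relabelled-injective π ρ λ C → begin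
      relabelled π C       ≡⟨ act-label π C ⟨
      act (label π) 𝓑 C    ≡⟨ same C ⟩
      act (label ρ) 𝓑 C    ≡⟨ act-label ρ C ⟩
      relabelled ρ C       ∎
      where open ≡-Reasoning

    labels-distinct : AllPairs (λ τ τ′ → ¬ (act τ 𝓑 ≈D act τ′ 𝓑)) (map label ps)
    labels-distinct = AllPairs-map (λ τ τ′ → ¬ (act τ 𝓑 ≈D act τ′ 𝓑)) label
      (λ π ρ π≉ρ same → π≉ρ (label-injective π ρ same)) distinctPs

    act-≈-label : ∀ τ μ π → act (lift μ) (act τ 𝓑) ≈D Dsh → μ ≈ₚ π → act τ 𝓑 ≈D act (label π) 𝓑
    act-≈-label τ μ π normalized μ≈π C = begin
      act τ 𝓑 C            ≡⟨ act-flip (lift μ) {act τ 𝓑} {Dsh} normalized C ⟩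
      relabelled μ C       ≡⟨ act-≈ Dsh {flipₚ (lift μ)} {flipₚ (lift π)} (flipₚ-cong (lift μ) (lift π) (lift-cong μ π μ≈π)) C ⟩
      relabelled π C       ≡⟨ act-label π C ⟨
      act (label π) 𝓑 C    ∎
      where open ≡-Reasoning

    -- The system 𝓑^τ is itself Steiner, so the classification carries it to 𝓓^sh by some `μ`;
    -- undoing `μ` exhibits it as the labelled system of the listed permutation equal to `μ`.
    labels-complete : SteinerSystem 𝓑 → ∀ τ → Any (λ τ′ → act τ 𝓑 ≈D act τ′ 𝓑) (map label ps)
    labels-complete steiner τ = let μ , normalized = relabel-to-Dsh (IsSteiner-act τ steiner) in
      Any-map (λ τ′ → act τ 𝓑 ≈D act τ′ 𝓑) label (λ π μ≈π → act-≈-label τ μ π normalized μ≈π) (completePs μ)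

    labels-enumerate : SteinerSystem 𝓑 → IsOrbitEnum 𝓑 (map label ps)
    labels-enumerate steiner = labels-distinct , labels-complete steiner

-- Independence of the enumeration, and the conclusion

Invariant : BlockSet 12 → (Permutation′ 12 → Bool) → Set
Invariant 𝓑 f = ∀ σ τ → act σ 𝓑 ≈D act τ 𝓑 → f σ ≡ f τ

module _ (𝓑 : BlockSet 12) where

  -- Each counted member of `L` has a representative of the same system in `L′`, counted there by
  -- invariance. Distinct members name distinct systems and so never share one.
  enumeration-≤ : ∀ L L′ → IsOrbitEnum 𝓑 L → IsOrbitEnum 𝓑 L′ → ∀ f → Invariant 𝓑 f → count f L ≤ count f L′
  enumeration-≤ L L′ enum enum′ f invariant = pigeonhole {R = λ σ τ → act σ 𝓑 ≈D act τ 𝓑}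
    (AllPairs.map (λ {σ} {σ′} σ≉σ′ τ e e′ → σ≉σ′ λ C → trans (e C) (sym (e′ C))) (AllPairsₚ.filter⁺ (Boolₚ.T? ∘ f) (proj₁ enum)))
    (All.tabulate λ {σ} σ∈ → let τ , τ∈ , e = find (proj₂ enum′ σ) in
      lose (∈-filterᵇ⁺ f τ∈ (trans (sym (invariant σ τ e)) (proj₂ (∈-filterᵇ⁻ f L σ∈)))) e)

  enumeration-≡ : ∀ L L′ → IsOrbitEnum 𝓑 L → IsOrbitEnum 𝓑 L′ → ∀ f → Invariant 𝓑 f → count f L ≡ count f L′
  enumeration-≡ L L′ enum enum′ f invariant = ℕₚ.≤-antisym
    (enumeration-≤ L L′ enum enum′ f invariant) (enumeration-≤ L′ L enum′ enum f invariant)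

  enumeration-length : ∀ L L′ → IsOrbitEnum 𝓑 L → IsOrbitEnum 𝓑 L′ → length L ≡ length L′
  enumeration-length L L′ enum enum′ = trans (sym (count-true L))
    (trans (enumeration-≡ L L′ enum enum′ (λ _ → true) (λ _ _ _ → refl)) (count-true L′))
    where
    count-true : ∀ xs → count (λ _ → true) xs ≡ length xs
    count-true []       = refl
    count-true (x ∷ xs) = cong suc (count-true xs)

∈-length-1 : {x y : A} {xs : List A} → length xs ≡ 1 → x ∈ₗ xs → y ∈ₗ xs → x ≡ y
∈-length-1 {xs = _ ∷ []} _ (here refl) (here refl) = refl

∈⇒length≢0 : {x : A} {xs : List A} → x ∈ₗ xs → length xs ≢ 0
∈⇒length≢0 (here _)  ()
∈⇒length≢0 (there _) ()

entry-bound : ∀ k t m → all (λ (n , _) → k ≤ᵇ n) t ≡ true → entry t m ≢ 0 → k ≤ m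
entry-bound k []            m h e = contradiction refl e
entry-bound k ((n , c) ∷ t) m h e with m ≡ᵇ n in m≡n
... | true  = subst (k ≤_) (sym (≡ᵇ-sound {m} {n} m≡n)) (≤ᵇ-sound (∧-trueˡ h))
... | false = entry-bound k t m (∧-trueʳ {k ≤ᵇ n} h) e

IsSteiner-cong : ∀ {𝓒 𝓓} → 𝓒 ≈D 𝓓 → SteinerSystem 𝓒 → SteinerSystem 𝓓
IsSteiner-cong {𝓒} {𝓓} h (sizes , covers) = (λ B b → sizes B (trans (h B) b)) , λ T s →
  let (B , b , T⊆B) , unique = covers T s in
  (B , trans (sym (h B)) b , λ {x} → T⊆B {x}) ,
  λ B B′ b s b′ s′ → unique B B′ (trans (h B) b) (λ {x} → s {x}) (trans (h B′) b′) (λ {x} → s′ {x})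

module Main (ps : List (Permutation′ 7)) (distinctPs : AllPairs _≉ₚ_ ps)
  (completePs : ∀ π → Any (π ≈ₚ_) ps) (K : List (Subset 12)) (hexads : all (hexad table) K ≡ true)
  (rigidPs : rigid table K ps ≡ true) (lengthPs : length ps ≡ 5040)
  (countPs : SteinerSystem Dsh → ∀ m → count (λ π → cardPbar (relabelled π) ≡ᵇ m) ps ≡ entry distribution m)
  (𝓑 : BlockSet 12) (steiner : SteinerSystem 𝓑) where

  open Orbit ps distinctPs completePs K hexads rigidPs

  σ : Permutation′ 12
  σ = lift (proj₁ (relabel-to-Dsh steiner))

  σ𝓑 : act σ 𝓑 ≈D Dsh
  σ𝓑 = proj₂ (relabel-to-Dsh steiner)

  open Labels 𝓑 σ σ𝓑

  orbit : List (Permutation′ 12)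
  orbit = map label ps

  enumerates : IsOrbitEnum 𝓑 orbit
  enumerates = labels-enumerate steiner

  -- No covering of the 792 five-sets is verified for 𝓓^sh: it is a relabelling of the given system
  -- and inherits the property.
  steiner-Dsh : SteinerSystem Dsh
  steiner-Dsh = IsSteiner-cong {act σ 𝓑} {Dsh} σ𝓑 (IsSteiner-act σ {𝓑} steiner)

  hasCard : ℕ → Permutation′ 12 → Bool
  hasCard m τ = cardPbar (act τ 𝓑) ≡ᵇ m

  hasCard-invariant : ∀ m → Invariant 𝓑 (hasCard m)
  hasCard-invariant m τ τ′ e = cong (_≡ᵇ m) (cardPbar-cong {act τ 𝓑} {act τ′ 𝓑} e)

  orbit-distribution : ∀ m → count (hasCard m) orbit ≡ entry distribution m
  orbit-distribution m = begin
    count (hasCard m) orbit                              ≡⟨ count-map (hasCard m) label ps ⟩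
    count (λ π → hasCard m (label π)) ps             ≡⟨ count-cong (λ π → cong (_≡ᵇ m) (cardPbar-cong {act (label π) 𝓑} {relabelled π} (act-label π))) ps ⟩
    count (λ π → cardPbar (relabelled π) ≡ᵇ m) ps        ≡⟨ countPs steiner-Dsh m ⟩
    entry distribution m                                 ∎
    where open ≡-Reasoning

  Represented : Permutation′ 12 → ℕ → Permutation′ 12 → Set
  Represented τ m τ′ = act τ 𝓑 ≈D act τ′ 𝓑 × τ′ ∈ₗ filterᵇ (hasCard m) orbit

  represent : ∀ τ m → cardPbar (act τ 𝓑) ≡ m → ∃ (Represented τ m)
  represent τ m e = let τ′ , τ′∈ , same = find (proj₂ enumerates τ) in
    τ′ , same , ∈-filterᵇ⁺ (hasCard m) τ′∈ (trans (sym (hasCard-invariant m τ τ′ same)) (trans (cong (_≡ᵇ m) e) (≡ᵇ-refl m)))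

  -- A system of value `m` makes the entry at `m` nonzero, and every key of the distribution is at
  -- least 905.
  minimum : ∀ τ m → cardPbar (act τ 𝓑) ≡ m → 905 ≤ m
  minimum τ m e = entry-bound 905 distribution m refl λ z →
    ∈⇒length≢0 (proj₂ (proj₂ (represent τ m e))) (trans (orbit-distribution m) z)

  -- The entry at 905 is 1, and 𝓑^σ = 𝓓^sh attains this value. Any other system attaining it shares
  -- the single representative.
  unique : ∀ τ → cardPbar (act τ 𝓑) ≡ 905 → act τ 𝓑 ≈D Dsh
  unique τ e C = begin
    act τ 𝓑 C             ≡⟨ proj₁ (proj₂ r) C ⟩
    act (proj₁ r) 𝓑 C      ≡⟨ cong (λ ρ → act ρ 𝓑 C) (∈-length-1 (orbit-distribution 905) (proj₂ (proj₂ r)) (proj₂ (proj₂ s))) ⟩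
    act (proj₁ s) 𝓑 C      ≡⟨ proj₁ (proj₂ s) C ⟨
    act σ 𝓑 C             ≡⟨ σ𝓑 C ⟩
    Dsh C                 ∎
    where
    open ≡-Reasoning
    r = represent τ 905 e
    s = represent σ 905 (trans (cardPbar-cong {act σ 𝓑} {Dsh} σ𝓑) cardPbar-Dsh)

  result : Σ (List (Permutation′ 12)) (λ L → IsOrbitEnum 𝓑 L)
    × ((L : List (Permutation′ 12)) → IsOrbitEnum 𝓑 L →
         length L ≡ 5040 × ((n : ℕ) → gameDist 𝓑 L n ≡ paperTable n))
    × ((P : Subset 12) → (inPbar 6 Dsh P ≡ true) ⇔ (inH P ≡ true))
    × Σ (Permutation′ 12) (λ π → act π 𝓑 ≈D Dsh)
    × cardPbar Dsh ≡ 905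
    × ((π : Permutation′ 12) → cardPbar (act π 𝓑) ≡ 905 → act π 𝓑 ≈D Dsh)
    × ((π : Permutation′ 12) → 905 ≤ cardPbar (act π 𝓑))
  result =
    (orbit , enumerates) ,
    (λ L enum →
      trans (enumeration-length 𝓑 L orbit enum enumerates) (trans (Listₚ.length-map label ps) lengthPs) ,
      -- `entry distribution n` unfolds to the very conditional that defines `paperTable n`,
      -- including the final 0 for all other n.
      λ n → trans (enumeration-≡ 𝓑 L orbit enum enumerates (hasCard n) (hasCard-invariant n)) (orbit-distribution n)) ,
    (λ P → mk⇔ (trans (sym (inPbar-Dsh P))) (trans (inPbar-Dsh P))) ,
    (σ , σ𝓑) ,
    cardPbar-Dsh ,
    unique ,
    (λ π → minimum π (cardPbar (act π 𝓑)) refl)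

theorem4p3 : (𝓑 : BlockSet 12) → IsSteiner 5 6 12 𝓑 →
    Σ (List (Permutation′ 12)) (λ L → IsOrbitEnum 𝓑 L)
    × ((L : List (Permutation′ 12)) → IsOrbitEnum 𝓑 L →
    length L ≡ 5040 × ((n : ℕ) → gameDist 𝓑 L n ≡ paperTable n))
    × ((P : Subset 12) → (inPbar 6 Dsh P ≡ true) ⇔ (inH P ≡ true))
    × Σ (Permutation′ 12) (λ π → act π 𝓑 ≈D Dsh)
    × cardPbar Dsh ≡ 905
    × ((π : Permutation′ 12) → cardPbar (act π 𝓑) ≡ 905 → act π 𝓑 ≈D Dsh)
    × ((π : Permutation′ 12) → 905 ≤ cardPbar (act π 𝓑))
theorem4p3 = Main.result (perms 7) (perms-distinct 7) (perms-complete 7)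
  generators generators-hexads rigid-perms length-perms count-relabelled
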